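{- Let $K \subsetneq L$ be a field extension, and let $A$ and $B$ be two $n$-dimensional $K$-subspaces of $L$, with $n > 0$ and $1 \notin A$. Assume that for every nonzero $K$-subspace $R$ of $B$, we have $$\dim_K (K(R) \cap A) \geq \dim_K R.$$ Then the pair $(A,B)$ is matchable.
   Context: Let $K\subsetneq L$ be a field extension and let $A,B$ be $n$-dimensional $K$-subspaces of $L$ with $n>0$. For a subset $X$ of $L$, $\langle X\rangle$ denotes the $K$-subspace of $L$ spanned by $X$. An ordered basis $\{a_1,\ldots,a_n\}$ of $A$ is matched to an ordered basis $\{b_1,\ldots,b_n\}$ of $B$ if, for each $i\in\{1,\ldots,n\}$, $a_i^{ -1}A\cap B\subseteq \langle b_1,\ldots,b_{i-1},b_{i+1},\ldots,b_n\rangle$. The subspace $A$ is matched to $B$ (equivalently, the pair $(A,B)$ is matchable) if every ordered basis of $A$ can be matched to some ordered basis of $B$. For a subset $R\subseteq L$, $K(R)$ denotes the smallest subfield of $L$ containing $K\cup R$. -}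

module Defs where

open import Algebra.Apartness.Bundles using (HeytingCommutativeRing; HeytingField)
open import Algebra.Bundles using (CommutativeRing)
open import Data.Fin.Base using (Fin)
open import Data.Nat.Base using (ℕ)
open import Data.Product.Base using (_×_; ∃-syntax)
open import Data.Vec.Functional using (Vector)
open import Level using (Level; _⊔_)
open import Relation.Binary.Definitions using (_Respects_)
open import Relation.Binary.PropositionalEquality.Core using (_≢_)
open import Relation.Nullary.Negation.Core using (¬_)
open import Relation.Unary using (Pred; _∈_; _⊆_; _∩_; _∪_)

import Algebra.Properties.Semiring.Sum as SemiringSum

private
  variable
    q r : Level
    n   : ℕ

-- Under excluded middle the tight apartness _#_ of a HeytingField coincides with
-- the negation of _≈_, so HeytingField is then the classical notion of field.
-- Subsets of a field are predicates. Structures on subsets (subfields, subspaces)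
-- include invariance under the setoid equality _≈_ of the field.

module Subfields {c ℓ₁ ℓ₂} (L : HeytingField c ℓ₁ ℓ₂) where

  open HeytingField L

  record IsSubfield (F : Pred Carrier q) : Set (c ⊔ ℓ₁ ⊔ q) where
    field
      resp-≈     : F Respects _≈_
      0∈         : 0# ∈ F
      1∈         : 1# ∈ F
      +-closed   : ∀ {x y} → x ∈ F → y ∈ F → x + y ∈ F
      neg-closed : ∀ {x} → x ∈ F → - x ∈ F
      *-closed   : ∀ {x y} → x ∈ F → y ∈ F → x * y ∈ F
      inv-closed : ∀ {x y} → x ∈ F → x * y ≈ 1# → y ∈ F

  -- The smallest subfield containing S; see generated-isSubfield and
  -- generated-minimal.
  data Generated (S : Pred Carrier q) : Pred Carrier (c ⊔ ℓ₁ ⊔ q) where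
    incl : ∀ {x} → x ∈ S → Generated S x
    resp : ∀ {x y} → x ≈ y → Generated S x → Generated S y
    nil  : Generated S 0#
    unit : Generated S 1#
    add  : ∀ {x y} → Generated S x → Generated S y → Generated S (x + y)
    neg  : ∀ {x} → Generated S x → Generated S (- x)
    mul  : ∀ {x y} → Generated S x → Generated S y → Generated S (x * y)
    inv  : ∀ {x y} → Generated S x → x * y ≈ 1# → Generated S y

  generated-isSubfield : (S : Pred Carrier q) → IsSubfield (Generated S)
  generated-isSubfield S = record
    { resp-≈     = resp
    ; 0∈         = nil
    ; 1∈         = unit
    ; +-closed   = add
    ; neg-closed = neg
    ; *-closed   = mul
    ; inv-closed = inv
    }

  generated-minimal : {S : Pred Carrier q} {F : Pred Carrier r} →
                      IsSubfield F → S ⊆ F → Generated S ⊆ F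
  generated-minimal {S = S} {F = F} isF S⊆F = go
    where
    module F = IsSubfield isF
    go : Generated S ⊆ F
    go (incl x∈S)   = S⊆F x∈S
    go (resp x≈y g) = F.resp-≈ x≈y (go g)
    go nil          = F.0∈
    go unit         = F.1∈
    go (add g h)    = F.+-closed (go g) (go h)
    go (neg g)      = F.neg-closed (go g)
    go (mul g h)    = F.*-closed (go g) (go h)
    go (inv g xy≈1) = F.inv-closed (go g) xy≈1

-- Linear algebra in L over a subset K of scalars, meant to be a subfield.

module LinearAlgebra {c ℓ₁ ℓ₂ p} (L : HeytingField c ℓ₁ ℓ₂)
                     (K : Pred (HeytingField.Carrier L) p) where

  open HeytingField L
  open Subfields L
  open HeytingCommutativeRing heytingCommutativeRing using (commutativeRing)
  open CommutativeRing commutativeRing using (semiring)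
  open SemiringSum semiring using (sum)

  record IsSubspace (V : Pred Carrier q) : Set (c ⊔ ℓ₁ ⊔ p ⊔ q) where
    field
      resp-≈   : V Respects _≈_
      0∈       : 0# ∈ V
      +-closed : ∀ {x y} → x ∈ V → y ∈ V → x + y ∈ V
      *-closed : ∀ {k x} → k ∈ K → x ∈ V → k * x ∈ V

  Nonzero : Pred Carrier q → Set (c ⊔ ℓ₁ ⊔ q)
  Nonzero V = ∃[ x ] x ∈ V × ¬ (x ≈ 0#)

  -- The smallest K-subspace containing X; see span-isSubspace and span-minimal.
  data ⟨_⟩ (X : Pred Carrier q) : Pred Carrier (c ⊔ ℓ₁ ⊔ p ⊔ q) where
    incl  : ∀ {x} → x ∈ X → ⟨ X ⟩ x
    resp  : ∀ {x y} → x ≈ y → ⟨ X ⟩ x → ⟨ X ⟩ y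
    nil   : ⟨ X ⟩ 0#
    add   : ∀ {x y} → ⟨ X ⟩ x → ⟨ X ⟩ y → ⟨ X ⟩ (x + y)
    scale : ∀ {k x} → k ∈ K → ⟨ X ⟩ x → ⟨ X ⟩ (k * x)

  span-isSubspace : (X : Pred Carrier q) → IsSubspace ⟨ X ⟩
  span-isSubspace X = record
    { resp-≈   = resp
    ; 0∈       = nil
    ; +-closed = add
    ; *-closed = scale
    }

  span-minimal : {X : Pred Carrier q} {V : Pred Carrier r} →
                 IsSubspace V → X ⊆ V → ⟨ X ⟩ ⊆ V
  span-minimal {X = X} {V = V} isV X⊆V = go
    where
    module V = IsSubspace isV
    go : ⟨ X ⟩ ⊆ V
    go (incl x∈X)    = X⊆V x∈X
    go (resp x≈y s)  = V.resp-≈ x≈y (go s)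
    go nil           = V.0∈
    go (add s t)     = V.+-closed (go s) (go t)
    go (scale k∈K s) = V.*-closed k∈K (go s)

  Range : Vector Carrier n → Pred Carrier ℓ₁
  Range v x = ∃[ i ] x ≈ v i

  LinearlyIndependent : Vector Carrier n → Set (c ⊔ ℓ₁ ⊔ p)
  LinearlyIndependent {n} v =
    (k : Vector Carrier n) → (∀ i → k i ∈ K) →
    sum (λ i → k i * v i) ≈ 0# → ∀ i → k i ≈ 0#

  record IsBasis (V : Pred Carrier q) (v : Vector Carrier n) : Set (c ⊔ ℓ₁ ⊔ p ⊔ q) where
    field
      members     : ∀ i → v i ∈ V
      independent : LinearlyIndependent v
      spanning    : V ⊆ ⟨ Range v ⟩

  HasDim : Pred Carrier q → ℕ → Set (c ⊔ ℓ₁ ⊔ p ⊔ q)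
  HasDim V n = ∃[ v ] IsBasis {n = n} V v

  -- K(R)
  Adjoin : Pred Carrier q → Pred Carrier (c ⊔ ℓ₁ ⊔ p ⊔ q)
  Adjoin R = Generated (K ∪ R)

  -- The translate a⁻¹A. There is no total inverse function on L, so the inverse
  -- of a is an element a⁻¹ with a * a⁻¹ ≈ 1# (unique if it exists; the
  -- translate is empty for a ≈ 0#, a case that does not occur for basis vectors).
  _⁻¹·_ : Carrier → Pred Carrier q → Pred Carrier (c ⊔ ℓ₁ ⊔ q)
  (a ⁻¹· A) y = ∃[ a⁻¹ ] a * a⁻¹ ≈ 1# × (∃[ x ] x ∈ A × y ≈ a⁻¹ * x)

  Others : Vector Carrier n → Fin n → Pred Carrier ℓ₁
  Others b i x = ∃[ j ] j ≢ i × x ≈ b j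

  MatchedBases : Pred Carrier q → Pred Carrier r →
                 Vector Carrier n → Vector Carrier n → Set (c ⊔ ℓ₁ ⊔ p ⊔ q ⊔ r)
  MatchedBases A B a b = ∀ i → (a i ⁻¹· A) ∩ B ⊆ ⟨ Others b i ⟩

  Matchable : ℕ → Pred Carrier q → Pred Carrier r → Set (c ⊔ ℓ₁ ⊔ p ⊔ q ⊔ r)
  Matchable n A B =
    (a : Vector Carrier n) → IsBasis A a →
    ∃[ b ] IsBasis {n = n} B b × MatchedBases A B a b

{-# OPTIONS --safe #-}
module Submission where

-- By Rado's theorem, applied to annihilators in the dual of B, a basis (aᵢ) of A is
-- matched to some basis of B as soon as the spaces Vᵢ = aᵢ⁻¹A ∩ B satisfy
-- dim (⋂ᵢ∈J Vᵢ) + |J| ≤ n for every J. With S = ⟨aᵢ : i ∈ J⟩ and R = ⋂ᵢ∈J Vᵢ we have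
-- SR ⊆ A, so it suffices that dim S + dim R ≤ dim A whenever S ⊆ A, R ⊆ B and SR ⊆ A.
-- This follows by a linear Dyson transform: if eR ⊈ S for some e ∈ S, replace S by S + eR
-- and R by R ∩ e⁻¹S, which keeps dim S + dim R and makes R smaller. Otherwise SR ⊆ S, so S
-- is a vector space over K(R) not containing 1, whence S ∩ K(R) = 0 and
-- dim S + dim R ≤ dim S + dim (K(R) ∩ A) ≤ dim A.

open import Defs
open import Algebra.Apartness.Bundles using (HeytingCommutativeRing; HeytingField)
open import Algebra.Bundles using (CommutativeRing)
open import Axiom.ExcludedMiddle using (ExcludedMiddle)
open import Data.Fin.Base using (Fin; zero; suc; punchIn)
open import Data.Fin.Properties using (_≟_; punchInᵢ≢i)
open import Data.Fin.Subset using (Subset; ∣_∣; ⁅_⁆; ∁; ⊤; inside; outside)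
  renaming (_∈_ to _∈ˢ_; _∪_ to _∪ˢ_; _∩_ to _∩ˢ_)
open import Data.Fin.Subset.Properties
open import Data.List.Base as List using (List)
open import Data.List.Membership.Propositional using () renaming (_∈_ to _∈ˡ_)
open import Data.List.Membership.Propositional.Properties using (∈-allFin)
open import Data.List.Relation.Unary.Any using (here; there)
open import Data.Nat.Base as ℕ using (ℕ; zero; suc; _>_; _≥_; _≤_; _<_; s≤s; z≤n)
open import Data.Nat.Induction using (<-wellFounded)
open import Data.Product.Base using (_×_; _,_; proj₁; proj₂; ∃-syntax; Σ-syntax)
open import Data.Sum.Base using (_⊎_; inj₁; inj₂)
open import Data.Vec.Base as Vec using (here; there)
open import Data.Vec.Functional using (Vector; []; _∷_; head; tail; updateAt)
open import Data.Vec.Functional.Properties using (updateAt-updates; updateAt-minimal)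
open import Function.Base using (_∘_; id)
open import Induction.WellFounded using (Acc; acc)
open import Level using (Lift; lift; lower) renaming (suc to lsuc; _⊔_ to _⊔ˡ_)
open import Relation.Binary.PropositionalEquality.Core as ≡ using (_≡_; _≢_)
open import Relation.Nullary using (¬_; yes; no; contradiction)
open import Relation.Nullary.Decidable using (True; toWitness; fromWitness)
open import Relation.Unary using (Pred; U; _∈_; _∉_; _⊆_; _⊂_; _∩_; _∪_)

import Data.Nat.Properties as ℕ
import Relation.Binary.Reasoning.Setoid

open import Algebra.Properties.CommutativeSemigroup ℕ.+-commutativeSemigroup
  using () renaming (interchange to interchangeℕ)

-- No dual space is formed. A nonzero functional on B, up to scalars, is its kernel, so choosing a
-- functional in the annihilator of `V i` becomes enlarging `V i` to a hyperplane of B, and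
-- independence of n functionals becomes that their kernels meet only in 0. The enlargement goes one
-- line at a time: of two directions independent modulo `V i`, submodularity lets at most one
-- destroy Rado's condition. The basis of B dual to the resulting functionals is the matched basis.
-- The inequality needed for Rado's condition concerns spans of some of the aᵢ, but the Dyson
-- transform leaves that class; hence the statement for arbitrary S and R. Dimension is measured by
-- chains of one-line extensions because cutting a chain by a subspace yields both uniqueness of
-- length and Grassmann's formula, without coordinates.

-- Cardinalities of finite index sets.

∣p∪q∣+∣p∩q∣ : ∀ {n} (p q : Subset n) → ∣ p ∪ˢ q ∣ ℕ.+ ∣ p ∩ˢ q ∣ ≡ ∣ p ∣ ℕ.+ ∣ q ∣
∣p∪q∣+∣p∩q∣ Vec.[] Vec.[] = ≡.refl
∣p∪q∣+∣p∩q∣ (outside Vec.∷ p) (outside Vec.∷ q) = ∣p∪q∣+∣p∩q∣ p q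
∣p∪q∣+∣p∩q∣ (outside Vec.∷ p) (inside  Vec.∷ q) =
  ≡.trans (≡.cong suc (∣p∪q∣+∣p∩q∣ p q)) (≡.sym (ℕ.+-suc ∣ p ∣ ∣ q ∣))
∣p∪q∣+∣p∩q∣ (inside  Vec.∷ p) (outside Vec.∷ q) = ≡.cong suc (∣p∪q∣+∣p∩q∣ p q)
∣p∪q∣+∣p∩q∣ (inside  Vec.∷ p) (inside  Vec.∷ q) = ≡.cong suc
  (≡.trans (ℕ.+-suc ∣ p ∪ˢ q ∣ ∣ p ∩ˢ q ∣)
    (≡.trans (≡.cong suc (∣p∪q∣+∣p∩q∣ p q)) (≡.sym (ℕ.+-suc ∣ p ∣ ∣ q ∣))))

∣p∣≤1+∣p∩∁⁅x⁆∣ : ∀ {n} (p : Subset n) x → ∣ p ∣ ≤ suc ∣ p ∩ˢ ∁ ⁅ x ⁆ ∣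
∣p∣≤1+∣p∩∁⁅x⁆∣ p x = begin
  ∣ p ∣                              ≤⟨ p⊆q⇒∣p∣≤∣q∣ p⊆ ⟩
  ∣ q ∪ˢ ⁅ x ⁆ ∣                     ≤⟨ ℕ.m≤m+n _ _ ⟩
  ∣ q ∪ˢ ⁅ x ⁆ ∣ ℕ.+ ∣ q ∩ˢ ⁅ x ⁆ ∣  ≡⟨ ∣p∪q∣+∣p∩q∣ q ⁅ x ⁆ ⟩
  ∣ q ∣ ℕ.+ ∣ ⁅ x ⁆ ∣                ≡⟨ ≡.cong (∣ q ∣ ℕ.+_) (∣⁅x⁆∣≡1 x) ⟩
  ∣ q ∣ ℕ.+ 1                        ≡⟨ ℕ.+-comm ∣ q ∣ 1 ⟩
  suc ∣ q ∣                          ∎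
  where
  open ℕ.≤-Reasoning
  q = p ∩ˢ ∁ ⁅ x ⁆
  p⊆ : ∀ {y} → y ∈ˢ p → y ∈ˢ q ∪ˢ ⁅ x ⁆
  p⊆ {y} y∈p with y ∈? ⁅ x ⁆
  ... | yes y∈ = x∈p∪q⁺ (inj₂ y∈)
  ... | no  y∉ = x∈p∪q⁺ (inj₁ (x∈p∩q⁺ (y∈p , x∉p⇒x∈∁p y∉)))

-- The lattice of K-subspaces of L.

module Subspaces
  (em : ∀ {a} → ExcludedMiddle a)
  {c ℓ₁ ℓ₂ p} (L : HeytingField c ℓ₁ ℓ₂)
  (K : Pred (HeytingField.Carrier L) p)
  (isSubfield : Subfields.IsSubfield L K)
  where

  open HeytingField L hiding (zero)
  open Subfields L
  open LinearAlgebra L K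

  commutativeRing : CommutativeRing c ℓ₁
  commutativeRing = HeytingCommutativeRing.commutativeRing heytingCommutativeRing

  open CommutativeRing commutativeRing using (ring; semiring; +-commutativeSemigroup; *-commutativeSemigroup)
  open import Algebra.Properties.Ring ring using (-1*x≈-x; -0#≈0#; -‿involutive; -‿distribˡ-*)
  open import Algebra.Properties.AbelianGroup (CommutativeRing.+-abelianGroup commutativeRing) using (xyx⁻¹≈y)
  open import Algebra.Properties.CommutativeSemigroup +-commutativeSemigroup using (interchange)
  open import Algebra.Properties.CommutativeSemigroup *-commutativeSemigroup using (x∙yz≈y∙xz; xy∙z≈xz∙y)
  open import Algebra.Properties.Semiring.Sum semiring using (sum; sum-remove)
  private
    module K = IsSubfield isSubfield
    module ≈-Reasoning = Relation.Binary.Reasoning.Setoid setoid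

  Λ = c ⊔ˡ ℓ₁ ⊔ˡ p

  ≉0⇒invertible : ∀ {x} → ¬ (x ≈ 0#) → ∃[ y ] y * x ≈ 1#
  ≉0⇒invertible {x} x≉0 with em {P = x # 0#}
  ... | no ¬x#0 = contradiction (proj₁ (tight x 0#) ¬x#0) x≉0
  ... | yes x#0 with #⇒invertible x#0
  ...   | y , y*x≈1 , _ = y , trans (*-congˡ (sym x-0≈x)) y*x≈1
    where
    x-0≈x : x - 0# ≈ x
    x-0≈x = trans (+-congˡ -0#≈0#) (+-identityʳ x)

  -- All subspaces share the level `Λ`, which is closed under spans of vectors, sums, intersections
  -- and `Adjoin`.
  record Subspace : Set (lsuc Λ) where
    no-eta-equality
    infix 4 _∋_
    field
      _∋_        : Pred Carrier Λ
      isSubspace : IsSubspace _∋_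
    open IsSubspace isSubspace public

    neg-closed : ∀ {x} → _∋_ x → _∋_ (- x)
    neg-closed {x} x∈ = resp-≈ (-1*x≈-x x) (*-closed (K.neg-closed K.1∈) x∈)

    cancelˡ : ∀ {x y z} → z ≈ x + y → _∋_ z → _∋_ x → _∋_ y
    cancelˡ {x} {y} {z} z≈x+y z∈ x∈ =
      resp-≈ (trans (+-congʳ z≈x+y) (xyx⁻¹≈y x y)) (+-closed z∈ (neg-closed x∈))

    cancelʳ : ∀ {x y z} → z ≈ x + y → _∋_ z → _∋_ y → _∋_ x
    cancelʳ z≈x+y = cancelˡ (trans z≈x+y (+-comm _ _))

    unscale : ∀ {k x} → k ∈ K → ¬ (k ≈ 0#) → _∋_ (k * x) → _∋_ x
    unscale {k} {x} k∈K k≉0 kx∈ with ≉0⇒invertible k≉0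
    ... | k⁻¹ , k⁻¹k≈1 = resp-≈
      (trans (sym (*-assoc k⁻¹ k x)) (trans (*-congʳ k⁻¹k≈1) (*-identityˡ x)))
      (*-closed (K.inv-closed k∈K (trans (*-comm k k⁻¹) k⁻¹k≈1)) kx∈)

  open Subspace public using (_∋_; isSubspace)

  infix 4 _⊑_ _≑_
  infixl 6 _⊔_
  infixl 7 _⊓_

  -- Wrapped in a record because membership in a compound subspace unfolds, so that `V` and `W`
  -- could not be recovered from a bare implication.
  record _⊑_ (V W : Subspace) : Set Λ where
    constructor ⊑-intro
    field ⊑-elim : ∀ {x} → V ∋ x → W ∋ x
  open _⊑_ public

  _≑_ : Subspace → Subspace → Set Λ
  V ≑ W = V ⊑ W × W ⊑ V

  ⊑-refl : ∀ {V} → V ⊑ V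
  ⊑-refl = ⊑-intro id

  ⊑-trans : ∀ {U V W} → U ⊑ V → V ⊑ W → U ⊑ W
  ⊑-trans U⊑V V⊑W = ⊑-intro (⊑-elim V⊑W ∘ ⊑-elim U⊑V)

  ≑-sym : ∀ {V W} → V ≑ W → W ≑ V
  ≑-sym (V⊑W , W⊑V) = W⊑V , V⊑W

  ≑-trans : ∀ {U V W} → U ≑ V → V ≑ W → U ≑ W
  ≑-trans (U⊑V , V⊑U) (V⊑W , W⊑V) = ⊑-trans U⊑V V⊑W , ⊑-trans W⊑V V⊑U

  ⊥ : Subspace
  ⊥ ._∋_ x = Lift Λ (x ≈ 0#)
  ⊥ .isSubspace = record
    { resp-≈   = λ { x≈y (lift x≈0) → lift (trans (sym x≈y) x≈0) }
    ; 0∈       = lift refl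
    ; +-closed = λ { (lift x≈0) (lift y≈0) → lift (trans (+-cong x≈0 y≈0) (+-identityˡ 0#)) }
    ; *-closed = λ { _ (lift x≈0) → lift (trans (*-congˡ x≈0) (zeroʳ _)) }
    }

  line : Carrier → Subspace
  line x ._∋_ y = ∃[ k ] k ∈ K × y ≈ k * x
  line x .isSubspace = record
    { resp-≈   = λ { y≈z (k , k∈K , y≈kx) → k , k∈K , trans (sym y≈z) y≈kx }
    ; 0∈       = 0# , K.0∈ , sym (zeroˡ x)
    ; +-closed = λ { (k , k∈K , y≈kx) (l , l∈K , z≈lx) →
        k + l , K.+-closed k∈K l∈K , trans (+-cong y≈kx z≈lx) (sym (distribʳ x k l)) }
    ; *-closed = λ { {l} l∈K (k , k∈K , y≈kx) →
        l * k , K.*-closed l∈K k∈K , trans (*-congˡ y≈kx) (sym (*-assoc l k x)) }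
    }

  _⊓_ : Subspace → Subspace → Subspace
  (V ⊓ W) ._∋_ x = V ∋ x × W ∋ x
  (V ⊓ W) .isSubspace = record
    { resp-≈   = λ { x≈y (x∈V , x∈W) → V.resp-≈ x≈y x∈V , W.resp-≈ x≈y x∈W }
    ; 0∈       = V.0∈ , W.0∈
    ; +-closed = λ { (x∈V , x∈W) (y∈V , y∈W) → V.+-closed x∈V y∈V , W.+-closed x∈W y∈W }
    ; *-closed = λ { k∈K (x∈V , x∈W) → V.*-closed k∈K x∈V , W.*-closed k∈K x∈W }
    }
    where
    module V = Subspace V
    module W = Subspace W

  _⊔_ : Subspace → Subspace → Subspace
  (V ⊔ W) ._∋_ x = ∃[ v ] V ∋ v × ∃[ w ] W ∋ w × x ≈ v + w
  (V ⊔ W) .isSubspace = record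
    { resp-≈   = λ { x≈y (v , v∈V , w , w∈W , x≈v+w) →
        v , v∈V , w , w∈W , trans (sym x≈y) x≈v+w }
    ; 0∈       = 0# , V.0∈ , 0# , W.0∈ , sym (+-identityˡ 0#)
    ; +-closed = λ { (v , v∈V , w , w∈W , x≈v+w) (v′ , v′∈V , w′ , w′∈W , y≈v′+w′) →
        v + v′ , V.+-closed v∈V v′∈V , w + w′ , W.+-closed w∈W w′∈W ,
        trans (+-cong x≈v+w y≈v′+w′) (interchange v w v′ w′) }
    ; *-closed = λ { {k} k∈K (v , v∈V , w , w∈W , x≈v+w) →
        k * v , V.*-closed k∈K v∈V , k * w , W.*-closed k∈K w∈W ,
        trans (*-congˡ x≈v+w) (distribˡ k v w) }
    }
    where
    module V = Subspace V
    module W = Subspace W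

  scaled : Carrier → Subspace → Subspace
  scaled e V ._∋_ y = ∃[ v ] V ∋ v × y ≈ e * v
  scaled e V .isSubspace = record
    { resp-≈   = λ { y≈z (v , v∈V , y≈ev) → v , v∈V , trans (sym y≈z) y≈ev }
    ; 0∈       = 0# , V.0∈ , sym (zeroʳ e)
    ; +-closed = λ { (v , v∈V , y≈ev) (w , w∈V , z≈ew) →
        v + w , V.+-closed v∈V w∈V , trans (+-cong y≈ev z≈ew) (sym (distribˡ e v w)) }
    ; *-closed = λ { {k} k∈K (v , v∈V , y≈ev) →
        k * v , V.*-closed k∈K v∈V , trans (*-congˡ y≈ev) (x∙yz≈y∙xz k e v) }
    }
    where module V = Subspace V

  preimage : Carrier → Subspace → Subspace
  preimage e V ._∋_ y = V ∋ e * y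
  preimage e V .isSubspace = record
    { resp-≈   = λ x≈y → V.resp-≈ (*-congˡ x≈y)
    ; 0∈       = V.resp-≈ (sym (zeroʳ e)) V.0∈
    ; +-closed = λ ex∈V ey∈V → V.resp-≈ (sym (distribˡ e _ _)) (V.+-closed ex∈V ey∈V)
    ; *-closed = λ {k} k∈K ex∈V → V.resp-≈ (x∙yz≈y∙xz k e _) (V.*-closed k∈K ex∈V)
    }
    where module V = Subspace V

  ⊥-min : ∀ V → ⊥ ⊑ V
  ⊥-min V = ⊑-intro λ { (lift x≈0) → Subspace.resp-≈ V (sym x≈0) (Subspace.0∈ V) }

  ⊓-lower₁ : ∀ V W → V ⊓ W ⊑ V
  ⊓-lower₁ V W = ⊑-intro proj₁

  ⊓-lower₂ : ∀ V W → V ⊓ W ⊑ W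
  ⊓-lower₂ V W = ⊑-intro proj₂

  ⊓-glb : ∀ {U V W} → U ⊑ V → U ⊑ W → U ⊑ V ⊓ W
  ⊓-glb U⊑V U⊑W = ⊑-intro λ x∈U → ⊑-elim U⊑V x∈U , ⊑-elim U⊑W x∈U

  ⊔-upper₁ : ∀ V W → V ⊑ V ⊔ W
  ⊔-upper₁ V W = ⊑-intro λ {x} x∈V → x , x∈V , 0# , Subspace.0∈ W , sym (+-identityʳ x)

  ⊔-upper₂ : ∀ V W → W ⊑ V ⊔ W
  ⊔-upper₂ V W = ⊑-intro λ {x} x∈W → 0# , Subspace.0∈ V , x , x∈W , sym (+-identityˡ x)

  ⊔-lub : ∀ {U V W} → U ⊑ W → V ⊑ W → U ⊔ V ⊑ W
  ⊔-lub {W = W} U⊑W V⊑W = ⊑-intro λ { (u , u∈U , v , v∈V , x≈u+v) →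
    Subspace.resp-≈ W (sym x≈u+v) (Subspace.+-closed W (⊑-elim U⊑W u∈U) (⊑-elim V⊑W v∈V)) }

  line-∋ : ∀ x → line x ∋ x
  line-∋ x = 1# , K.1∈ , sym (*-identityˡ x)

  line-min : ∀ {x} V → V ∋ x → line x ⊑ V
  line-min V x∈V = ⊑-intro λ { (k , k∈K , y≈kx) →
    Subspace.resp-≈ V (sym y≈kx) (Subspace.*-closed V k∈K x∈V) }

  ⊓-cong : ∀ {V V′ W W′} → V ⊑ V′ → W ⊑ W′ → V ⊓ W ⊑ V′ ⊓ W′
  ⊓-cong {V} {V′} {W} {W′} V⊑ W⊑ = ⊓-glb (⊑-trans (⊓-lower₁ V W) V⊑) (⊑-trans (⊓-lower₂ V W) W⊑)

  ⊔-cong : ∀ {V V′ W W′} → V ⊑ V′ → W ⊑ W′ → V ⊔ W ⊑ V′ ⊔ W′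
  ⊔-cong {V} {V′} {W} {W′} V⊑ W⊑ = ⊔-lub (⊑-trans V⊑ (⊔-upper₁ V′ W′)) (⊑-trans W⊑ (⊔-upper₂ V′ W′))

  modular : ∀ V W X → X ⊑ W → (V ⊔ X) ⊓ W ⊑ (V ⊓ W) ⊔ X
  modular V W X X⊑W = ⊑-intro λ { ((v , v∈V , x , x∈X , y≈v+x) , y∈W) →
    v , (v∈V , Subspace.cancelʳ W y≈v+x y∈W (⊑-elim X⊑W x∈X)) , x , x∈X , y≈v+x }

  line-∩ : ∀ V {x y} → ¬ (V ∋ x) → line x ∋ y → V ∋ y → y ≈ 0#
  line-∩ V {x} {y} x∉V (k , k∈K , y≈kx) y∈V with em {P = k ≈ 0#}
  ... | yes k≈0 = trans y≈kx (trans (*-congʳ k≈0) (zeroˡ x))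
  ... | no  k≉0 = contradiction (Subspace.unscale V k∈K k≉0 (Subspace.resp-≈ V y≈kx y∈V)) x∉V

  -- Steinitz exchange. The component of y along x lies in W, being y - v; were x outside W, it
  -- would vanish and leave y = v in V.
  line-exchange : ∀ V W {x y} → V ⊑ W → (V ⊔ line x) ∋ y → W ∋ y → ¬ (V ∋ y) → W ∋ x
  line-exchange V W {x} {y} V⊑W (v , v∈V , z , z∈x , y≈v+z) y∈W y∉V with em {P = W ∋ x}
  ... | yes x∈W = x∈W
  ... | no  x∉W = contradiction (Subspace.resp-≈ V (sym y≈v) v∈V) y∉V
    where
    z∈W : W ∋ z
    z∈W = Subspace.cancelˡ W y≈v+z y∈W (⊑-elim V⊑W v∈V)
    y≈v : y ≈ v
    y≈v = trans y≈v+z (trans (+-congˡ (line-∩ W x∉W z∈x z∈W)) (+-identityʳ v))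

  -- Dimension, as the length of a chain of one-dimensional extensions

  data Chain (V : Subspace) : ℕ → Subspace → Set (lsuc Λ) where
    base   : ∀ {W} → V ≑ W → Chain V 0 W
    extend : ∀ {k W W′ x} → Chain V k W → ¬ (W ∋ x) → W′ ≑ W ⊔ line x → Chain V (suc k) W′

  chain-respʳ : ∀ {V W W′ k} → W ≑ W′ → Chain V k W → Chain V k W′
  chain-respʳ W≑W′ (base V≑W)        = base (≑-trans V≑W W≑W′)
  chain-respʳ W≑W′ (extend ch x∉ eq) = extend ch x∉ (≑-trans (≑-sym W≑W′) eq)

  chain-++ : ∀ {U V W i j} → Chain U i V → Chain V j W → Chain U (j ℕ.+ i) W
  chain-++ ch (base V≑W)         = chain-respʳ V≑W ch
  chain-++ ch (extend ch′ x∉ eq) = extend (chain-++ ch ch′) x∉ eq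

  chain-respˡ : ∀ {V V′ W k} → V′ ≑ V → Chain V k W → Chain V′ k W
  chain-respˡ {k = k} eq ch = ≡.subst (λ j → Chain _ j _) (ℕ.+-identityʳ k) (chain-++ (base eq) ch)

  chain-⊑ : ∀ {V W k} → Chain V k W → V ⊑ W
  chain-⊑ (base (V⊑W , _))           = V⊑W
  chain-⊑ (extend ch _ (_ , W⊔x⊑W′)) = ⊑-trans (chain-⊑ ch) (⊑-trans (⊔-upper₁ _ _) W⊔x⊑W′)

  -- Each step of a chain survives in exactly one of the two chains cut out by C.
  chain-⊓-⊔ : ∀ {V W k} → Chain V k W → ∀ C →
              ∃[ i ] ∃[ j ] i ℕ.+ j ≡ k × Chain (V ⊓ C) i (W ⊓ C) × Chain (V ⊔ C) j (W ⊔ C)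
  chain-⊓-⊔ (base (V⊑W , W⊑V)) C =
    0 , 0 , ≡.refl ,
    base (⊓-cong V⊑W ⊑-refl , ⊓-cong W⊑V ⊑-refl) ,
    base (⊔-cong V⊑W ⊑-refl , ⊔-cong W⊑V ⊑-refl)
  chain-⊓-⊔ (extend {W = W} {W′} {x} ch x∉W (W′⊑ , ⊑W′)) C
    with chain-⊓-⊔ ch C | em {P = (W ⊔ C) ∋ x}
  -- Modulo W the vectors x and c agree, so c generates the same extension. It lies in C, so the
  -- step survives in the ⊓ chain, by the modular law.
  ... | i , j , i+j≡k , ch₁ , ch₂ | yes (w , w∈W , c , c∈C , x≈w+c) =
    suc i , j , ≡.cong suc i+j≡k ,
    extend ch₁ (c∉W ∘ proj₁)
      ( ⊑-trans (⊓-cong (⊑-trans W′⊑ (⊔-lub (⊔-upper₁ _ _) x⊑W⊔c)) ⊑-refl)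
                (modular W C (line c) (line-min C c∈C))
      , ⊔-lub (⊓-cong W⊑W′ ⊑-refl) (⊓-glb (line-min W′ c∈W′) (line-min C c∈C)) ) ,
    chain-respʳ
      ( ⊔-cong W⊑W′ ⊑-refl
      , ⊔-lub (⊑-trans W′⊑ (⊔-lub (⊔-upper₁ W C) (line-min (W ⊔ C) (w , w∈W , c , c∈C , x≈w+c))))
              (⊔-upper₂ W C) )
      ch₂
    where
    W⊑W′ : W ⊑ W′
    W⊑W′ = ⊑-trans (⊔-upper₁ _ _) ⊑W′
    x∈W′ : W′ ∋ x
    x∈W′ = ⊑-elim ⊑W′ (⊑-elim (⊔-upper₂ W (line x)) (line-∋ x))
    c∈W′ : W′ ∋ c
    c∈W′ = Subspace.cancelˡ W′ x≈w+c x∈W′ (⊑-elim W⊑W′ w∈W)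
    c∉W : ¬ (W ∋ c)
    c∉W c∈W = x∉W (Subspace.resp-≈ W (sym x≈w+c) (Subspace.+-closed W w∈W c∈W))
    x⊑W⊔c : line x ⊑ W ⊔ line c
    x⊑W⊔c = line-min (W ⊔ line c) (w , w∈W , c , line-∋ c , x≈w+c)
  ... | i , j , i+j≡k , ch₁ , ch₂ | no x∉W⊔C =
    i , suc j , ≡.trans (ℕ.+-suc i j) (≡.cong suc i+j≡k) ,
    chain-respʳ
      ( ⊓-cong W⊑W′ ⊑-refl
      , ⊑-intro λ { (y∈W′ , y∈C) → W∋ y∈W′ y∈C , y∈C } )
      ch₁ ,
    extend ch₂ x∉W⊔C
      ( ⊔-lub (⊑-trans W′⊑ (⊔-cong (⊔-upper₁ W C) ⊑-refl))
              (⊑-trans (⊔-upper₂ W C) (⊔-upper₁ (W ⊔ C) (line x)))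
      , ⊔-lub (⊔-cong W⊑W′ ⊑-refl)
              (⊑-trans (⊑-trans (⊔-upper₂ W (line x)) ⊑W′) (⊔-upper₁ W′ C)) )
    where
    W⊑W′ : W ⊑ W′
    W⊑W′ = ⊑-trans (⊔-upper₁ _ _) ⊑W′
    -- An element of C that is new in W′ would put x into `W ⊔ C` by exchange.
    W∋ : ∀ {y} → W′ ∋ y → C ∋ y → W ∋ y
    W∋ {y} y∈W′ y∈C with em {P = W ∋ y}
    ... | yes y∈W = y∈W
    ... | no  y∉W = contradiction
      (line-exchange W (W ⊔ C) (⊔-upper₁ W C) (⊑-elim W′⊑ y∈W′) (⊑-elim (⊔-upper₂ W C) y∈C) y∉W)
      x∉W⊔C

  -- Nothing lies strictly between V and V + Kx. With two or more steps, exchange applied to the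
  -- vector y of the last step but one already puts x into W₂, so W₂ is all of W and the last step
  -- cannot be proper.
  chain-covering : ∀ {V W x l} → ¬ (V ∋ x) → W ≑ V ⊔ line x → Chain V l W → l ≡ 1
  chain-covering {V} {W} {x} x∉V (_ , ⊑W) (base (_ , W⊑V)) =
    contradiction (⊑-elim W⊑V (⊑-elim ⊑W (⊑-elim (⊔-upper₂ V (line x)) (line-∋ x)))) x∉V
  chain-covering x∉V _ (extend (base _) _ _) = ≡.refl
  chain-covering {V} {W} {x} x∉V (W⊑ , ⊑W)
    (extend {W = W₂} {x = z} (extend {W = W₁} {x = y} ch y∉W₁ (_ , ⊑W₂)) z∉W₂ (_ , W₂⊔z⊑W)) =
    contradiction (⊑-elim W⊑W₂ (⊑-elim W₂⊔z⊑W (⊑-elim (⊔-upper₂ W₂ (line z)) (line-∋ z)))) z∉W₂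
    where
    V⊑W₂ : V ⊑ W₂
    V⊑W₂ = ⊑-trans (chain-⊑ ch) (⊑-trans (⊔-upper₁ _ _) ⊑W₂)
    y∈W₂ : W₂ ∋ y
    y∈W₂ = ⊑-elim ⊑W₂ (⊑-elim (⊔-upper₂ W₁ (line y)) (line-∋ y))
    y∈V⊔x : (V ⊔ line x) ∋ y
    y∈V⊔x = ⊑-elim W⊑ (⊑-elim W₂⊔z⊑W (⊑-elim (⊔-upper₁ W₂ (line z)) y∈W₂))
    x∈W₂ : W₂ ∋ x
    x∈W₂ = line-exchange V W₂ V⊑W₂ y∈V⊔x y∈W₂ (y∉W₁ ∘ ⊑-elim (chain-⊑ ch))
    W⊑W₂ : W ⊑ W₂
    W⊑W₂ = ⊑-trans W⊑ (⊔-lub V⊑W₂ (line-min W₂ x∈W₂))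

  -- Cutting by V itself gives chains from U ⊓ V = U to W ⊓ V = V and from U ⊔ V = V to W ⊔ V = W.
  chain-between : ∀ {U V W k} → Chain U k W → U ⊑ V → V ⊑ W →
                  ∃[ i ] ∃[ j ] i ℕ.+ j ≡ k × Chain U i V × Chain V j W
  chain-between {U} {V} {W} ch U⊑V V⊑W with chain-⊓-⊔ ch V
  ... | i , j , i+j≡k , ch₁ , ch₂ =
    i , j , i+j≡k ,
    chain-respˡ (⊓-glb ⊑-refl U⊑V , ⊓-lower₁ U V)
      (chain-respʳ (⊓-lower₂ W V , ⊓-glb V⊑W ⊑-refl) ch₁) ,
    chain-respˡ (⊔-upper₂ U V , ⊔-lub U⊑V ⊑-refl)
      (chain-respʳ (⊔-lub ⊑-refl V⊑W , ⊔-upper₁ W V) ch₂)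

  -- A Jordan-Hölder argument: the first chain is refined through the last but one member of the
  -- second. Its upper part has length one by covering, and its lower part is compared by recursion.
  chain-unique : ∀ {V W k l} → Chain V k W → Chain V l W → k ≡ l
  chain-unique (base _) (base _) = ≡.refl
  chain-unique (extend {W = W} {x = x} ch x∉W (_ , ⊑W′)) (base (_ , W′⊑V)) =
    contradiction (⊑-elim (chain-⊑ ch) (⊑-elim W′⊑V (⊑-elim ⊑W′ (⊑-elim (⊔-upper₂ W (line x)) (line-∋ x))))) x∉W
  chain-unique ch (extend {W = W} ch′ x∉W eq)
    with chain-between ch (chain-⊑ ch′) (⊑-trans (⊔-upper₁ _ _) (proj₂ eq))
  ... | i , j , i+j≡k , ch₁ , ch₂ with chain-covering x∉W eq ch₂ | chain-unique ch₁ ch′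
  ...   | ≡.refl | ≡.refl = ≡.trans (≡.sym i+j≡k) (ℕ.+-comm i 1)

  Dim : Subspace → ℕ → Set (lsuc Λ)
  Dim V d = Chain ⊥ d V

  dim-⊥ : Dim ⊥ 0
  dim-⊥ = base (⊑-refl , ⊑-refl)

  dim-⊑ : ∀ {V W w} → V ⊑ W → Dim W w → ∃[ v ] Dim V v
  dim-⊑ {V} V⊑W dimW with chain-between dimW (⊥-min V) V⊑W
  ... | i , _ , _ , dimV , _ = i , dimV

  dim-mono : ∀ {V W v w} → V ⊑ W → Dim V v → Dim W w → v ≤ w
  dim-mono {V} V⊑W dimV dimW with chain-between dimW (⊥-min V) V⊑W
  ... | i , j , ≡.refl , dimV′ , _ with chain-unique dimV dimV′
  ...   | ≡.refl = ℕ.m≤m+n i j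

  dim-⊑-≥ : ∀ {V W v w} → V ⊑ W → Dim V v → Dim W w → v ≥ w → W ⊑ V
  dim-⊑-≥ {V} {W} V⊑W dimV dimW v≥w with chain-between dimW (⊥-min V) V⊑W
  ... | i , j , ≡.refl , dimV′ , ch with chain-unique dimV dimV′
  dim-⊑-≥ _ _ _ _   | i , zero  , ≡.refl , _ , base (_ , W⊑V) | ≡.refl = W⊑V
  dim-⊑-≥ _ _ _ v≥w | i , suc j , ≡.refl , _ , _ | ≡.refl =
    contradiction v≥w (ℕ.<⇒≱ (ℕ.m<m+n i (s≤s z≤n)))

  -- Grassmann's formula: cutting a chain for V by W splits v into dim (V ⊓ W) and the length of a
  -- chain from W to V ⊔ W, which is then put on top of a chain for W.
  dim-⊓-⊔ : ∀ {V W v w} → Dim V v → Dim W w →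
            ∃[ i ] ∃[ j ] Dim (V ⊓ W) i × Dim (V ⊔ W) j × i ℕ.+ j ≡ v ℕ.+ w
  dim-⊓-⊔ {V} {W} {v} {w} dimV dimW with chain-⊓-⊔ dimV W
  ... | i , j , i+j≡v , ch₁ , ch₂ =
    i , j ℕ.+ w ,
    chain-respˡ (⊥-min (⊥ ⊓ W) , ⊓-lower₁ ⊥ W) ch₁ ,
    chain-++ dimW (chain-respˡ (⊔-upper₂ ⊥ W , ⊔-lub (⊥-min W) ⊑-refl) ch₂) ,
    ≡.trans (≡.sym (ℕ.+-assoc i j w)) (≡.cong (ℕ._+ w) i+j≡v)

  dim-adjoin : ∀ {V x d} → Dim V d → ¬ (V ∋ x) → Dim (V ⊔ line x) (suc d)
  dim-adjoin dimV x∉V = extend dimV x∉V (⊑-refl , ⊑-refl)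

  dim-< : ∀ {V W v w} → Dim V v → Dim W w → v < w → ∃[ x ] W ∋ x × ¬ (V ∋ x)
  dim-< {V} {W} dimV dimW v<w with em {P = ∃[ x ] W ∋ x × ¬ (V ∋ x)}
  ... | yes ∃x = ∃x
  ... | no ∄x  = contradiction (dim-mono (⊑-intro W⊑V) dimW dimV) (ℕ.<⇒≱ v<w)
    where
    W⊑V : ∀ {x} → W ∋ x → V ∋ x
    W⊑V {x} x∈W with em {P = V ∋ x}
    ... | yes x∈V = x∈V
    ... | no x∉V  = contradiction (x , x∈W , x∉V) ∄x

  -- Multiplication by a nonzero element.

  chain-scaled : ∀ {V W k e} → ¬ (e ≈ 0#) → Chain V k W → Chain (scaled e V) k (scaled e W)
  chain-scaled e≉0 (base (V⊑W , W⊑V)) = base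
    ( ⊑-intro (λ { (v , v∈ , eq) → v , ⊑-elim V⊑W v∈ , eq })
    , ⊑-intro (λ { (v , v∈ , eq) → v , ⊑-elim W⊑V v∈ , eq }) )
  chain-scaled {e = e} e≉0 (extend {W = W} {W′} {x} ch x∉W (W′⊑ , ⊑W′)) =
    extend (chain-scaled e≉0 ch) ex∉
      ( ⊑-intro (λ { (v , v∈ , y≈ev) → split y≈ev (⊑-elim W′⊑ v∈) })
      , ⊔-lub (⊑-intro λ { (w , w∈ , eq) → w , ⊑-elim ⊑W′ (⊑-elim (⊔-upper₁ W (line x)) w∈) , eq })
              (line-min (scaled e W′) (x , ⊑-elim ⊑W′ (⊑-elim (⊔-upper₂ W (line x)) (line-∋ x)) , refl)) )
    where
    ex∉ : ¬ (scaled e W ∋ e * x)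
    ex∉ (w , w∈W , ex≈ew) with ≉0⇒invertible e≉0
    ... | e⁻¹ , e⁻¹e≈1 = x∉W (Subspace.resp-≈ W w≈x w∈W)
      where
      open ≈-Reasoning
      w≈x : w ≈ x
      w≈x = begin
        w              ≈⟨ *-identityˡ w ⟨
        1# * w         ≈⟨ *-congʳ e⁻¹e≈1 ⟨
        e⁻¹ * e * w    ≈⟨ *-assoc e⁻¹ e w ⟩
        e⁻¹ * (e * w)  ≈⟨ *-congˡ ex≈ew ⟨
        e⁻¹ * (e * x)  ≈⟨ *-assoc e⁻¹ e x ⟨
        e⁻¹ * e * x    ≈⟨ *-congʳ e⁻¹e≈1 ⟩
        1# * x         ≈⟨ *-identityˡ x ⟩
        x              ∎
    split : ∀ {y v} → y ≈ e * v → (W ⊔ line x) ∋ v → (scaled e W ⊔ line (e * x)) ∋ y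
    split y≈ev (w , w∈W , z , (k , k∈K , z≈kx) , v≈w+z) =
      e * w , (w , w∈W , refl) , e * z , (k , k∈K , trans (*-congˡ z≈kx) (x∙yz≈y∙xz e k x)) ,
      trans y≈ev (trans (*-congˡ v≈w+z) (distribˡ e w z))

  dim-scaled : ∀ {V d e} → ¬ (e ≈ 0#) → Dim V d → Dim (scaled e V) d
  dim-scaled {e = e} e≉0 dimV = chain-respˡ
    (⊥-min _ , ⊑-intro λ { (v , lift v≈0 , y≈ev) → lift (trans y≈ev (trans (*-congˡ v≈0) (zeroʳ e))) })
    (chain-scaled e≉0 dimV)

  ∌*⇒≉0 : ∀ V {x y} → ¬ (V ∋ x * y) → ¬ (x ≈ 0#)
  ∌*⇒≉0 V xy∉V x≈0 = xy∉V (Subspace.resp-≈ V (sym (trans (*-congʳ x≈0) (zeroˡ _))) (Subspace.0∈ V))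

  sum-closed : ∀ V {n} (f : Vector Carrier n) → (∀ i → V ∋ f i) → V ∋ sum f
  sum-closed V {zero}  f f∈ = Subspace.0∈ V
  sum-closed V {suc n} f f∈ = Subspace.+-closed V (f∈ zero) (sum-closed V (tail f) (f∈ ∘ suc))

  sum-summand : ∀ V {n} (f : Vector Carrier n) i → (∀ j → j ≢ i → V ∋ f j) → V ∋ sum f → V ∋ f i
  sum-summand V {suc n} f i f∈ ∑∈ =
    Subspace.cancelʳ V (sum-remove f) ∑∈ (sum-closed V _ λ j → f∈ (punchIn i j) (punchInᵢ≢i i j))

  -- Spans and bases, and their agreement with chain dimension.

  span : ∀ {n} → Vector Carrier n → Subspace
  span v ._∋_ = ⟨ Range v ⟩
  span v .isSubspace = span-isSubspace (Range v)

  span-⊑ : ∀ {n} {v : Vector Carrier n} V → (∀ i → V ∋ v i) → span v ⊑ V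
  span-⊑ V v∈V = ⊑-intro (span-minimal (isSubspace V) λ { (i , x≈vi) → Subspace.resp-≈ V (sym x≈vi) (v∈V i) })

  span-[] : (v : Vector Carrier 0) → ⊥ ≑ span v
  span-[] v = ⊥-min (span v) , span-⊑ ⊥ λ ()

  span-∷ : ∀ {n} (v : Vector Carrier (suc n)) → span v ≑ span (tail v) ⊔ line (head v)
  span-∷ v =
    span-⊑ (span (tail v) ⊔ line (head v)) (λ
      { zero    → ⊑-elim (⊔-upper₂ (span (tail v)) (line (head v))) (line-∋ (head v))
      ; (suc i) → ⊑-elim (⊔-upper₁ (span (tail v)) (line (head v))) (incl (i , refl)) }) ,
    ⊔-lub (span-⊑ (span v) λ i → incl (suc i , refl)) (line-min (span v) (incl (zero , refl)))

  span-sum : ∀ {n} (v : Vector Carrier n) {y} → span v ∋ y →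
             Σ[ k ∈ Vector Carrier n ] (∀ i → k i ∈ K) × y ≈ sum (λ i → k i * v i)
  span-sum {zero}  v y∈ = (λ ()) , (λ ()) , lower (⊑-elim (proj₂ (span-[] v)) y∈)
  span-sum {suc n} v y∈ with ⊑-elim (proj₁ (span-∷ v)) y∈
  ... | w , w∈ , z , (l , l∈K , z≈lv₀) , y≈w+z with span-sum (tail v) w∈
  ...   | k , k∈K , w≈∑ =
    l ∷ k , (λ { zero → l∈K ; (suc i) → k∈K i }) ,
    trans y≈w+z (trans (+-comm w z) (+-cong z≈lv₀ w≈∑))

  independent-tail : ∀ {n} (v : Vector Carrier (suc n)) →
                     LinearlyIndependent v → LinearlyIndependent (tail v)
  independent-tail v ind k k∈K ∑≈0 i =
    ind (0# ∷ k) (λ { zero → K.0∈ ; (suc j) → k∈K j })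
      (trans (+-cong (zeroˡ (v zero)) ∑≈0) (+-identityˡ 0#)) (suc i)

  independent-head : ¬ (1# ≈ 0#) → ∀ {n} (v : Vector Carrier (suc n)) →
                     LinearlyIndependent v → ¬ (span (tail v) ∋ head v)
  independent-head 1≉0 v ind v₀∈ with span-sum (tail v) v₀∈
  ... | k , k∈K , v₀≈∑ = 1≉0 (begin
    1#      ≈⟨ -‿involutive 1# ⟨
    - - 1#  ≈⟨ -‿cong -1≈0 ⟩
    - 0#    ≈⟨ -0#≈0# ⟩
    0#      ∎)
    where
    open ≈-Reasoning
    -- The expansion of `v zero` in the tail is a linear relation with coefficient -1 at `v zero`.
    -1≈0 : - 1# ≈ 0#
    -1≈0 = ind (- 1# ∷ k) (λ { zero → K.neg-closed K.1∈ ; (suc j) → k∈K j })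
      (trans (+-cong (-1*x≈-x (v zero)) (sym v₀≈∑)) (-‿inverseˡ (v zero))) zero

  independent⇒dim : ¬ (1# ≈ 0#) → ∀ {n} (v : Vector Carrier n) → LinearlyIndependent v → Dim (span v) n
  independent⇒dim 1≉0 {zero}  v ind = base (span-[] v)
  independent⇒dim 1≉0 {suc n} v ind =
    extend (independent⇒dim 1≉0 (tail v) (independent-tail v ind)) (independent-head 1≉0 v ind) (span-∷ v)

  basis⇒≑span : ∀ {n V} {v : Vector Carrier n} → IsBasis (V ∋_) v → span v ≑ V
  basis⇒≑span {V = V} basis = span-⊑ V members , ⊑-intro spanning
    where open IsBasis basis

  hasDim⇒dim : ¬ (1# ≈ 0#) → ∀ {n V} → HasDim (V ∋_) n → Dim V n
  hasDim⇒dim 1≉0 {V = V} (v , basis) =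
    chain-respʳ (basis⇒≑span {V = V} basis) (independent⇒dim 1≉0 v (IsBasis.independent basis))

  dim⇒hasDim : ∀ {V d} → Dim V d → HasDim (V ∋_) d
  dim⇒hasDim (base (_ , V⊑⊥)) = [] , record
    { members     = λ ()
    ; independent = λ _ _ _ ()
    ; spanning    = ⊑-elim (⊑-trans V⊑⊥ (proj₁ (span-[] [])))
    }
  dim⇒hasDim (extend {W = W} {V} {x} ch x∉W (V⊑ , ⊑V)) with dim⇒hasDim ch
  ... | v , basis = x ∷ v , record
    { members     = λ
      { zero    → ⊑-elim ⊑V (⊑-elim (⊔-upper₂ W (line x)) (line-∋ x))
      ; (suc i) → ⊑-elim ⊑V (⊑-elim (⊔-upper₁ W (line x)) (members i)) }
    ; independent = ind
    ; spanning    = ⊑-elim (⊑-trans V⊑ (⊑-trans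
        (⊔-cong (proj₂ (basis⇒≑span {V = W} basis)) ⊑-refl)
        (proj₂ (span-∷ (x ∷ v)))))
    }
    where
    open IsBasis basis
    ind : LinearlyIndependent (x ∷ v)
    ind k k∈K ∑≈0 = λ { zero → k₀≈0 ; (suc i) → independent (tail k) (k∈K ∘ suc) ∑tail≈0 i }
      where
      ∑tail = sum (λ i → k (suc i) * v i)
      ∑tail∈W : W ∋ ∑tail
      ∑tail∈W = sum-closed W _ λ i → Subspace.*-closed W (k∈K (suc i)) (members i)
      k₀≈0 : k zero ≈ 0#
      k₀≈0 with em {P = k zero ≈ 0#}
      ... | yes k₀≈0 = k₀≈0
      ... | no  k₀≉0 = contradiction
        (Subspace.unscale W (k∈K zero) k₀≉0
          (Subspace.cancelʳ W (sym ∑≈0) (Subspace.0∈ W) ∑tail∈W))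
        x∉W
      ∑tail≈0 : ∑tail ≈ 0#
      ∑tail≈0 = begin
        ∑tail               ≈⟨ +-identityˡ ∑tail ⟨
        0# + ∑tail          ≈⟨ +-congʳ (trans (*-congʳ k₀≈0) (zeroˡ x)) ⟨
        k zero * x + ∑tail  ≈⟨ ∑≈0 ⟩
        0#                  ∎
        where open ≈-Reasoning

  -- Subfields acting on a subspace.

  -- By minimality of K(R), this upgrades stability of S under R to stability under K(R).
  stabilizer-isSubfield : ∀ {S s} → Dim S s → IsSubfield (λ x → ∀ {y} → S ∋ y → S ∋ x * y)
  stabilizer-isSubfield {S} dimS = record
    { resp-≈     = λ x≈x′ xS⊆S y∈S → S.resp-≈ (*-congʳ x≈x′) (xS⊆S y∈S)
    ; 0∈         = λ y∈S → S.resp-≈ (sym (zeroˡ _)) S.0∈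
    ; 1∈         = λ y∈S → S.resp-≈ (sym (*-identityˡ _)) y∈S
    ; +-closed   = λ xS⊆S x′S⊆S y∈S → S.resp-≈ (sym (distribʳ _ _ _)) (S.+-closed (xS⊆S y∈S) (x′S⊆S y∈S))
    ; neg-closed = λ xS⊆S y∈S → S.resp-≈ (-‿distribˡ-* _ _) (S.neg-closed (xS⊆S y∈S))
    ; *-closed   = λ xS⊆S x′S⊆S y∈S → S.resp-≈ (sym (*-assoc _ _ _)) (xS⊆S (x′S⊆S y∈S))
    ; inv-closed = inverse
    }
    where
    open ≈-Reasoning
    module S = Subspace S
    -- Multiplication by x is injective on the finite-dimensional S, hence onto S.
    inverse : ∀ {x x⁻¹} → (∀ {y} → S ∋ y → S ∋ x * y) → x * x⁻¹ ≈ 1# → ∀ {y} → S ∋ y → S ∋ x⁻¹ * y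
    inverse {x} {x⁻¹} xS⊆S xx⁻¹≈1 {y} y∈S with em {P = x ≈ 0#}
    -- Here 1 = x x⁻¹ = 0, so every element is 0.
    ... | yes x≈0 = S.resp-≈ (sym (begin
      x⁻¹ * y         ≈⟨ *-identityˡ _ ⟨
      1# * (x⁻¹ * y)  ≈⟨ *-congʳ (trans (sym xx⁻¹≈1) (trans (*-congʳ x≈0) (zeroˡ x⁻¹))) ⟩
      0# * (x⁻¹ * y)  ≈⟨ zeroˡ _ ⟩
      0#              ∎)) S.0∈
    ... | no x≉0 with ⊑-elim (dim-⊑-≥
                        (⊑-intro λ { (v , v∈S , z≈xv) → S.resp-≈ (sym z≈xv) (xS⊆S v∈S) })
                        (dim-scaled x≉0 dimS) dimS ℕ.≤-refl) y∈S
    ...   | v , v∈S , y≈xv = S.resp-≈ (begin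
      v              ≈⟨ *-identityˡ v ⟨
      1# * v         ≈⟨ *-congʳ (trans (sym xx⁻¹≈1) (*-comm x x⁻¹)) ⟩
      x⁻¹ * x * v    ≈⟨ *-assoc x⁻¹ x v ⟩
      x⁻¹ * (x * v)  ≈⟨ *-congˡ y≈xv ⟨
      x⁻¹ * y        ∎) v∈S

  adjoin : Subspace → Subspace
  adjoin R ._∋_ = Adjoin (R ∋_)
  adjoin R .isSubspace = record
    { resp-≈   = resp
    ; 0∈       = nil
    ; +-closed = add
    ; *-closed = λ k∈K → mul (incl (inj₁ k∈K))
    }

  -- The linear Dyson transform.

  module Transform
    (A B : Subspace) {n} (dimA : Dim A n) (1∉A : ¬ (A ∋ 1#))
    (adjoin-large : ∀ {R r s} → R ⊑ B → Nonzero (R ∋_) → Dim R r → Dim (adjoin R ⊓ A) s → s ≥ r)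
    where

    dim-+-stable : ∀ {S R s r} → S ⊑ A → R ⊑ B → (∀ {x y} → S ∋ x → R ∋ y → S ∋ x * y) →
                   Dim S s → Dim R r → s ℕ.+ r ≤ n
    -- R = 0 has to be treated apart, since `adjoin-large` speaks of nonzero R.
    dim-+-stable {s = s} {zero} S⊑A _ _ dimS _ =
      ≡.subst (_≤ n) (≡.sym (ℕ.+-identityʳ s)) (dim-mono S⊑A dimS dimA)
    dim-+-stable {S} {R} {s} {suc r} S⊑A R⊑B SR⊆S dimS dimR
      -- K(R) itself may be infinite-dimensional; K(R) ∩ A has a dimension because A has.
      with dim-⊑ (⊓-lower₂ (adjoin R) A) dimA | dim-< dim-⊥ dimR (s≤s z≤n)
    ... | f , dimFA | y , y∈R , y∉⊥ with dim-⊓-⊔ dimS dimFA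
    ...   | i , j , dim⊓ , dim⊔ , i+j≡s+f = begin
      s ℕ.+ suc r  ≤⟨ ℕ.+-monoʳ-≤ s (adjoin-large R⊑B (y , y∈R , y∉⊥ ∘ lift) dimR dimFA) ⟩
      s ℕ.+ f      ≡⟨ i+j≡s+f ⟨
      i ℕ.+ j      ≤⟨ ℕ.+-mono-≤ i≤0 (dim-mono (⊔-lub S⊑A (⊓-lower₂ (adjoin R) A)) dim⊔ dimA) ⟩
      n            ∎
      where
      open ℕ.≤-Reasoning
      module S = Subspace S
      F-stable : ∀ {x} → adjoin R ∋ x → ∀ {y} → S ∋ y → S ∋ x * y
      F-stable = generated-minimal (stabilizer-isSubfield dimS) λ
        { (inj₁ x∈K) → S.*-closed x∈K
        ; (inj₂ x∈R) → λ y∈S → S.resp-≈ (*-comm _ _) (SR⊆S y∈S x∈R) }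
      -- A nonzero x in both has x⁻¹ in K(R), which maps x ∈ S to 1 ∈ S ⊆ A.
      disjoint : ∀ {x} → (S ⊓ (adjoin R ⊓ A)) ∋ x → ⊥ ∋ x
      disjoint {x} (x∈S , x∈F , _) with em {P = x ≈ 0#}
      ... | yes x≈0 = lift x≈0
      ... | no  x≉0 with ≉0⇒invertible x≉0
      ...   | x⁻¹ , x⁻¹x≈1 = contradiction
        (⊑-elim S⊑A (S.resp-≈ x⁻¹x≈1 (F-stable (inv x∈F (trans (*-comm x x⁻¹) x⁻¹x≈1)) x∈S))) 1∉A
      i≤0 : i ≤ 0
      i≤0 = dim-mono (⊑-intro disjoint) dim⊓ dim-⊥

    dim-+-acc : ∀ {S R s r} → Acc _<_ r → S ⊑ A → R ⊑ B → (∀ {x y} → S ∋ x → R ∋ y → A ∋ x * y) →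
                Dim S s → Dim R r → s ℕ.+ r ≤ n
    dim-+-acc {S} {R} {s} {r} (acc rec) S⊑A R⊑B SR⊆A dimS dimR
      with em {P = ∃[ e ] ∃[ y ] S ∋ e × R ∋ y × ¬ (S ∋ e * y)}
    ... | no ∄ = dim-+-stable S⊑A R⊑B SR⊆S dimS dimR
      where
      SR⊆S : ∀ {x y} → S ∋ x → R ∋ y → S ∋ x * y
      SR⊆S {x} {y} x∈S y∈R with em {P = S ∋ x * y}
      ... | yes xy∈S = xy∈S
      ... | no  xy∉S = contradiction (x , y , x∈S , y∈R , xy∉S) ∄
    ... | yes (e , y , e∈S , y∈R , ey∉S)
      with dim-⊓-⊔ dimS (dim-scaled (∌*⇒≉0 S ey∉S) dimR) | dim-⊑ (⊓-lower₁ R (preimage e S)) dimR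
    ...   | i , j , dim⊓ , dim⊔ , i+j≡s+r | r′ , dimR′ =
      ≡.subst (_≤ n) j+r′≡s+r (dim-+-acc (rec r′<r) S′⊑A (⊑-trans R′⊑R R⊑B) S′R′⊆A dim⊔ dimR′)
      where
      R′ = R ⊓ preimage e S
      S′ = S ⊔ scaled e R
      R′⊑R : R′ ⊑ R
      R′⊑R = ⊓-lower₁ R (preimage e S)
      -- The part eR′ removed from R is exactly the overlap in S + eR, so Grassmann's formula keeps
      -- the sum of dimensions.
      eR′≑S⊓eR : scaled e R′ ≑ S ⊓ scaled e R
      eR′≑S⊓eR =
        ⊑-intro (λ { (v , (v∈R , ev∈S) , x≈ev) → Subspace.resp-≈ S (sym x≈ev) ev∈S , v , v∈R , x≈ev }) ,
        ⊑-intro (λ { (x∈S , v , v∈R , x≈ev) → v , (v∈R , Subspace.resp-≈ S x≈ev x∈S) , x≈ev })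
      j+r′≡s+r : j ℕ.+ r′ ≡ s ℕ.+ r
      j+r′≡s+r with chain-unique (chain-respʳ eR′≑S⊓eR (dim-scaled (∌*⇒≉0 S ey∉S) dimR′)) dim⊓
      ... | ≡.refl = ≡.trans (ℕ.+-comm j i) i+j≡s+r
      -- The witness y lies in R but not in R′, because ey ∉ S.
      r′<r : r′ < r
      r′<r = ℕ.≰⇒> λ r≤r′ → ey∉S (proj₂ (⊑-elim (dim-⊑-≥ R′⊑R dimR′ dimR r≤r′) y∈R))
      S′⊑A : S′ ⊑ A
      S′⊑A = ⊔-lub S⊑A (⊑-intro λ { (v , v∈R , x≈ev) → Subspace.resp-≈ A (sym x≈ev) (SR⊆A e∈S v∈R) })
      -- By commutativity (eR)R′ = (eR′)R ⊆ SR.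
      S′R′⊆A : ∀ {x z} → S′ ∋ x → R′ ∋ z → A ∋ x * z
      S′R′⊆A {x} {z} (v , v∈S , w , (u , u∈R , w≈eu) , x≈v+w) (z∈R , ez∈S) =
        Subspace.resp-≈ A (begin
          v * z + e * z * u  ≈⟨ +-congˡ (xy∙z≈xz∙y e z u) ⟩
          v * z + e * u * z  ≈⟨ +-congˡ (*-congʳ w≈eu) ⟨
          v * z + w * z      ≈⟨ distribʳ z v w ⟨
          (v + w) * z        ≈⟨ *-congʳ x≈v+w ⟨
          x * z              ∎)
          (Subspace.+-closed A (SR⊆A v∈S z∈R) (SR⊆A ez∈S u∈R))
        where open ≈-Reasoning

    dim-+-≤ : ∀ {S R s r} → S ⊑ A → R ⊑ B → (∀ {x y} → S ∋ x → R ∋ y → A ∋ x * y) →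
              Dim S s → Dim R r → s ℕ.+ r ≤ n
    dim-+-≤ {r = r} = dim-+-acc (<-wellFounded r)

  -- Rado's theorem, in terms of kernels.

  module Transversal (B : Subspace) {n} (dimB : Dim B n) where

    -- The conjunct `B ∋ x` makes the empty meet B rather than L and keeps every meet
    -- finite-dimensional.
    Meet : ∀ {m} → Subset m → Vector Subspace m → Subspace
    Meet J V ._∋_ x = B ∋ x × (∀ {i} → i ∈ˢ J → V i ∋ x)
    Meet J V .isSubspace = record
      { resp-≈   = λ { x≈y (x∈B , x∈V) → B.resp-≈ x≈y x∈B , λ {i} i∈J → Subspace.resp-≈ (V i) x≈y (x∈V i∈J) }
      ; 0∈       = B.0∈ , λ {i} _ → Subspace.0∈ (V i)
      ; +-closed = λ { (x∈B , x∈V) (y∈B , y∈V) →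
          B.+-closed x∈B y∈B , λ {i} i∈J → Subspace.+-closed (V i) (x∈V i∈J) (y∈V i∈J) }
      ; *-closed = λ { k∈K (x∈B , x∈V) →
          B.*-closed k∈K x∈B , λ {i} i∈J → Subspace.*-closed (V i) k∈K (x∈V i∈J) }
      }
      where module B = Subspace B

    Meet-⊑ : ∀ {m} (J : Subset m) V → Meet J V ⊑ B
    Meet-⊑ J V = ⊑-intro proj₁

    -- Rado's condition for the annihilators of the V i, in terms of codimensions.
    RadoCondition : ∀ {m} → Vector Subspace m → Set _
    RadoCondition V = ∀ J {d} → Dim (Meet J V) d → d ℕ.+ ∣ J ∣ ≤ n

    Violation : ∀ {m} → Vector Subspace m → Set _
    Violation V = ∃[ J ] ∃[ d ] Dim (Meet J V) d × n < d ℕ.+ ∣ J ∣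

    rado-or-violation : ∀ {m} (V : Vector Subspace m) → RadoCondition V ⊎ Violation V
    rado-or-violation V with em {P = Violation V}
    ... | yes violation = inj₂ violation
    ... | no ¬violation = inj₁ λ J dimJ → ℕ.≮⇒≥ λ n< → ¬violation (J , _ , dimJ , n<)

    enlarge : ∀ {m} → Vector Subspace m → Fin m → Carrier → Vector Subspace m
    enlarge V i x = updateAt V i (_⊔ line x)

    module _ {m} (V : Vector Subspace m) (i : Fin m) where

      enlarge-at : ∀ x {y} → enlarge V i x i ∋ y → (V i ⊔ line x) ∋ y
      enlarge-at x = ≡.subst (_∋ _) (updateAt-updates i V)

      enlarge-off : ∀ x {j y} → j ≢ i → enlarge V i x j ∋ y → V j ∋ y
      enlarge-off x {j} j≢i = ≡.subst (_∋ _) (updateAt-minimal j i V j≢i)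

      -- A meet that does not involve i is untouched by the enlargement and still obeys the bound
      -- for V.
      violation-at : ∀ {x} → RadoCondition V → ((J , _) : Violation (enlarge V i x)) → i ∈ˢ J
      violation-at {x} rado (J , d , dimJ , n<) with i ∈? J
      ... | yes i∈J = i∈J
      ... | no  i∉J with dim-⊑ (Meet-⊑ J V) dimB
      ...   | d′ , dimJ′ = contradiction
        (ℕ.≤-trans (ℕ.+-monoˡ-≤ ∣ J ∣ (dim-mono unchanged dimJ dimJ′)) (rado J dimJ′)) (ℕ.<⇒≱ n<)
        where
        unchanged : Meet J (enlarge V i x) ⊑ Meet J V
        unchanged = ⊑-intro λ { (y∈B , y∈V) → y∈B , λ {j} j∈J →
          enlarge-off x (λ { ≡.refl → i∉J j∈J }) (y∈V j∈J) }

      -- Submodularity of dimension: the meet of the two violating spaces lies in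
      -- Meet (J ∪ J′) V and their join in Meet (J ∩ J′ ∖ {i}) V.
      violations-exclusive : ∀ {x y} → ¬ ((V i ⊔ line x) ∋ y) → RadoCondition V →
                             Violation (enlarge V i x) → ¬ Violation (enlarge V i y)
      violations-exclusive {x} {y} y∉V⊔x rado vx@(J , d , dimJ , n<) vy@(J′ , d′ , dimJ′ , n<′)
        with dim-⊓-⊔ dimJ dimJ′ | dim-⊑ (Meet-⊑ (J ∪ˢ J′) V) dimB | dim-⊑ (Meet-⊑ ((J ∩ˢ J′) ∩ˢ ∁ ⁅ i ⁆) V) dimB
      ... | a , b , dim⊓ , dim⊔ , a+b≡d+d′ | u , dimU | v , dimD =
        -- Two violations amount to at least 2(n + 1), whereas the bounds for union and intersection
        -- allow only n + (n + 1).
        ℕ.<-irrefl ≡.refl (begin-strict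
          n ℕ.+ suc n                                            <⟨ ℕ.n<1+n _ ⟩
          suc n ℕ.+ suc n                                        ≤⟨ ℕ.+-mono-≤ n< n<′ ⟩
          (d ℕ.+ ∣ J ∣) ℕ.+ (d′ ℕ.+ ∣ J′ ∣)                      ≡⟨ interchangeℕ d _ d′ _ ⟩
          (d ℕ.+ d′) ℕ.+ (∣ J ∣ ℕ.+ ∣ J′ ∣)                      ≡⟨ ≡.cong₂ ℕ._+_ (≡.sym a+b≡d+d′) (≡.sym (∣p∪q∣+∣p∩q∣ J J′)) ⟩
          (a ℕ.+ b) ℕ.+ (∣ J ∪ˢ J′ ∣ ℕ.+ ∣ J ∩ˢ J′ ∣)            ≡⟨ interchangeℕ a b _ _ ⟩
          (a ℕ.+ ∣ J ∪ˢ J′ ∣) ℕ.+ (b ℕ.+ ∣ J ∩ˢ J′ ∣)            ≤⟨ ℕ.+-mono-≤ meet-bound join-bound ⟩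
          n ℕ.+ suc n                                            ∎)
        where
        open ℕ.≤-Reasoning
        D = (J ∩ˢ J′) ∩ˢ ∁ ⁅ i ⁆
        meet⊑ : Meet J (enlarge V i x) ⊓ Meet J′ (enlarge V i y) ⊑ Meet (J ∪ˢ J′) V
        meet⊑ = ⊑-intro λ { {z} ((z∈B , z∈V) , (_ , z∈V′)) → z∈B , λ {j} j∈J∪J′ → ∈V z z∈V z∈V′ j j∈J∪J′ }
          where
          -- The two enlargements of `V i` meet only in `V i`, since by exchange a further common
          -- element would put y into `V i ⊔ line x`.
          ∈Vi : ∀ {z} → (V i ⊔ line x) ∋ z → (V i ⊔ line y) ∋ z → V i ∋ z
          ∈Vi {z} z∈V⊔x z∈V⊔y with em {P = V i ∋ z}
          ... | yes z∈Vi = z∈Vi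
          ... | no  z∉Vi = contradiction
            (line-exchange (V i) (V i ⊔ line x) (⊔-upper₁ _ _) z∈V⊔y z∈V⊔x z∉Vi) y∉V⊔x
          ∈V : ∀ z → (∀ {j} → j ∈ˢ J → enlarge V i x j ∋ z) → (∀ {j} → j ∈ˢ J′ → enlarge V i y j ∋ z) →
               ∀ j → j ∈ˢ J ∪ˢ J′ → V j ∋ z
          ∈V z z∈V z∈V′ j j∈∪ with j ≟ i | x∈p∪q⁻ J J′ j∈∪
          ... | no j≢i | inj₁ j∈J  = enlarge-off x j≢i (z∈V j∈J)
          ... | no j≢i | inj₂ j∈J′ = enlarge-off y j≢i (z∈V′ j∈J′)
          ... | yes ≡.refl | _ = ∈Vi (enlarge-at x (z∈V (violation-at rado vx)))
                                     (enlarge-at y (z∈V′ (violation-at rado vy)))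
        join⊑ : Meet J (enlarge V i x) ⊔ Meet J′ (enlarge V i y) ⊑ Meet D V
        join⊑ = ⊔-lub
          (⊑-intro λ { (z∈B , z∈V) → z∈B , λ j∈D → enlarge-off x (D≢i j∈D) (z∈V (proj₁ (D⊆J∩J′ j∈D))) })
          (⊑-intro λ { (z∈B , z∈V) → z∈B , λ j∈D → enlarge-off y (D≢i j∈D) (z∈V (proj₂ (D⊆J∩J′ j∈D))) })
          where
          D⊆J∩J′ : ∀ {j} → j ∈ˢ D → j ∈ˢ J × j ∈ˢ J′
          D⊆J∩J′ j∈D = x∈p∩q⁻ J J′ (proj₁ (x∈p∩q⁻ (J ∩ˢ J′) _ j∈D))
          D≢i : ∀ {j} → j ∈ˢ D → j ≢ i
          D≢i j∈D ≡.refl = x∈∁p⇒x∉p (proj₂ (x∈p∩q⁻ (J ∩ˢ J′) _ j∈D)) (x∈⁅x⁆ i)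
        meet-bound : a ℕ.+ ∣ J ∪ˢ J′ ∣ ≤ n
        meet-bound = ℕ.≤-trans (ℕ.+-monoˡ-≤ _ (dim-mono meet⊑ dim⊓ dimU)) (rado (J ∪ˢ J′) dimU)
        -- At i the join is only known to satisfy enlarged conditions, so i is dropped from J ∩ J′;
        -- this costs the extra 1.
        join-bound : b ℕ.+ ∣ J ∩ˢ J′ ∣ ≤ suc n
        join-bound = begin
          b ℕ.+ ∣ J ∩ˢ J′ ∣  ≤⟨ ℕ.+-mono-≤ (dim-mono join⊑ dim⊔ dimD) (∣p∣≤1+∣p∩∁⁅x⁆∣ (J ∩ˢ J′) i) ⟩
          v ℕ.+ suc ∣ D ∣    ≡⟨ ℕ.+-suc v ∣ D ∣ ⟩
          suc (v ℕ.+ ∣ D ∣)  ≤⟨ s≤s (rado D dimD) ⟩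
          suc n              ∎

    -- Codimension at least 2 leaves room in B for two directions independent modulo `V i`, and they
    -- cannot both produce a violation.
    enlarge-rado : ∀ {m} (V : Vector Subspace m) i {d} → V i ⊑ B → Dim (V i) d → suc d < n →
                   RadoCondition V → ∃[ x ] B ∋ x × ¬ (V i ∋ x) × RadoCondition (enlarge V i x)
    enlarge-rado V i V⊑B dimV 1+d<n rado
      with dim-< dimV dimB (ℕ.<-trans (ℕ.n<1+n _) 1+d<n)
    ... | x , x∈B , x∉V with dim-< (dim-adjoin dimV x∉V) dimB 1+d<n
    ...   | y , y∈B , y∉V⊔x with rado-or-violation (enlarge V i x) | rado-or-violation (enlarge V i y)
    ...     | inj₁ radox | _ = x , x∈B , x∉V , radox
    ...     | inj₂ _ | inj₁ radoy = y , y∈B , y∉V⊔x ∘ ⊑-elim (⊔-upper₁ (V i) (line x)) , radoy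
    ...     | inj₂ vx | inj₂ vy = contradiction vy (violations-exclusive V i y∉V⊔x rado vx)

    Hyperplane : Subspace → Set _
    Hyperplane H = ∃[ d ] Dim H d × suc d ≡ n

    record Enlargement {m} (V W : Vector Subspace m) : Set (lsuc Λ) where
      field
        above   : ∀ i → V i ⊑ W i
        below   : ∀ i → W i ⊑ B
        isRado  : RadoCondition W

    -- The counter `g` is the number of lines still to be added before `V i` is a hyperplane. The
    -- last component lets hyperplanes already obtained at other indices survive.
    saturate-at : ∀ {m} (V : Vector Subspace m) i g {d} → (∀ j → V j ⊑ B) → RadoCondition V →
                  Dim (V i) d → g ℕ.+ suc d ≡ n →
                  ∃[ W ] Enlargement V W × Hyperplane (W i) × (∀ j → j ≢ i → W j ≡ V j)
    saturate-at V i zero V⊑B rado dimV 1+d≡n =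
      V , record { above = λ _ → ⊑-refl ; below = V⊑B ; isRado = rado } , (_ , dimV , 1+d≡n) , λ _ _ → ≡.refl
    saturate-at V i (suc g) {d} V⊑B rado dimV eq
      with enlarge-rado V i (V⊑B i) dimV (≡.subst (suc d <_) eq (s≤s (ℕ.m≤n+m (suc d) g))) rado
    ... | x , x∈B , x∉V , rado′ with saturate-at (enlarge V i x) i g {suc d} V′⊑B rado′
           (≡.subst (λ X → Dim X (suc d)) (≡.sym (updateAt-updates i V)) (dim-adjoin dimV x∉V))
           (≡.trans (ℕ.+-suc g (suc d)) eq)
      where
      V′⊑B : ∀ j → enlarge V i x j ⊑ B
      V′⊑B j with j ≟ i
      ... | yes ≡.refl = ≡.subst (_⊑ B) (≡.sym (updateAt-updates i V)) (⊔-lub (V⊑B i) (line-min B x∈B))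
      ... | no j≢i = ≡.subst (_⊑ B) (≡.sym (updateAt-minimal j i V j≢i)) (V⊑B j)
    ...   | W , enl , hyper , same =
      W , record { above = λ j → ⊑-trans (V⊑V′ j) (above j) ; below = below ; isRado = isRado } ,
      hyper , λ j j≢i → ≡.trans (same j j≢i) (updateAt-minimal j i V j≢i)
      where
      open Enlargement enl
      V⊑V′ : ∀ j → V j ⊑ enlarge V i x j
      V⊑V′ j with j ≟ i
      ... | yes ≡.refl = ≡.subst (V i ⊑_) (≡.sym (updateAt-updates i V)) (⊔-upper₁ (V i) (line x))
      ... | no j≢i = ≡.subst (V j ⊑_) (≡.sym (updateAt-minimal j i V j≢i)) ⊑-refl

    saturate : ∀ {m} (V : Vector Subspace m) (is : List (Fin m)) → (∀ j → V j ⊑ B) → RadoCondition V →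
               ∃[ W ] Enlargement V W × (∀ {i} → i ∈ˡ is → Hyperplane (W i))
    saturate V List.[] V⊑B rado =
      V , record { above = λ _ → ⊑-refl ; below = V⊑B ; isRado = rado } , λ ()
    saturate V (i List.∷ is) V⊑B rado with saturate V is V⊑B rado
    ... | W , enl , hyper with dim-⊑ (Enlargement.below enl i) dimB
    ...   | d , dimW with saturate-at W i (n ℕ.∸ suc d) (Enlargement.below enl) (Enlargement.isRado enl) dimW
                            (ℕ.m∸n+n≡m d<n)
      where
      W≑Meet : W i ≑ Meet ⁅ i ⁆ W
      W≑Meet =
        ⊑-intro (λ x∈W → ⊑-elim (Enlargement.below enl i) x∈W ,
          λ {j} j∈ → ≡.subst (λ k → W k ∋ _) (≡.sym (x∈⁅y⁆⇒x≡y i j∈)) x∈W) ,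
        ⊑-intro (λ { (_ , x∈W) → x∈W (x∈⁅x⁆ i) })
      -- Rado's condition for the singleton {i} says d + 1 ≤ n: no member is all of B.
      d<n : d < n
      d<n = ≡.subst (_≤ n) (≡.trans (≡.cong (d ℕ.+_) (∣⁅x⁆∣≡1 i)) (ℕ.+-comm d 1))
              (Enlargement.isRado enl ⁅ i ⁆ (chain-respʳ W≑Meet dimW))
    ...     | W′ , enl′ , hyperᵢ , same =
      W′ ,
      record
        { above  = λ j → ⊑-trans (Enlargement.above enl j) (Enlargement.above enl′ j)
        ; below  = Enlargement.below enl′
        ; isRado = Enlargement.isRado enl′
        } ,
      hyper′
      where
      hyper′ : ∀ {j} → j ∈ˡ i List.∷ is → Hyperplane (W′ j)
      hyper′ {j} j∈ with j ≟ i
      hyper′ _          | yes ≡.refl = hyperᵢ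
      hyper′ (here j≡i) | no j≢i     = contradiction j≡i j≢i
      hyper′ (there j∈) | no j≢i     = ≡.subst Hyperplane (≡.sym (same _ j≢i)) (hyper j∈)

    -- Each hyperplane lowers the dimension by at most one, by Grassmann's formula inside B. This is
    -- the inequality opposite to Rado's condition.
    Meet-hyperplanes : ∀ {m} J (H : Vector Subspace m) → (∀ i → H i ⊑ B) → (∀ i → Hyperplane (H i)) →
                       ∀ {d} → Dim (Meet J H) d → n ≤ d ℕ.+ ∣ J ∣
    Meet-hyperplanes Vec.[] H _ _ {d} dimJ =
      ≡.subst (n ≤_) (≡.sym (ℕ.+-identityʳ d))
        (dim-mono (⊑-intro λ x∈B → x∈B , λ ()) dimB dimJ)
    Meet-hyperplanes (outside Vec.∷ J) H H⊑B hyper dimJ =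
      Meet-hyperplanes J (tail H) (H⊑B ∘ suc) (hyper ∘ suc) (chain-respʳ
        ( ⊑-intro (λ { (x∈B , x∈H) → x∈B , λ j∈J → x∈H (there j∈J) })
        , ⊑-intro (λ { (x∈B , x∈H) → x∈B , λ { (there j∈J) → x∈H j∈J } }) ) dimJ)
    Meet-hyperplanes (inside Vec.∷ J) H H⊑B hyper {d} dimJ
      with hyper zero | dim-⊑ (Meet-⊑ J (tail H)) dimB
    ... | h , dimH₀ , 1+h≡n | t , dimT with dim-⊓-⊔ dimH₀ dimT
    ...   | i , j , dim⊓ , dim⊔ , i+j≡h+t = begin
      n                  ≤⟨ Meet-hyperplanes J (tail H) (H⊑B ∘ suc) (hyper ∘ suc) dimT ⟩
      t ℕ.+ ∣ J ∣        ≤⟨ ℕ.+-monoˡ-≤ ∣ J ∣ t≤1+d ⟩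
      suc d ℕ.+ ∣ J ∣    ≡⟨ ℕ.+-suc d ∣ J ∣ ⟨
      d ℕ.+ suc ∣ J ∣    ∎
      where
      open ℕ.≤-Reasoning
      meet⊑ : H zero ⊓ Meet J (tail H) ⊑ Meet (inside Vec.∷ J) H
      meet⊑ = ⊑-intro λ { (x∈H₀ , x∈B , x∈H) → x∈B , λ { here → x∈H₀ ; (there j∈J) → x∈H j∈J } }
      t≤1+d : t ≤ suc d
      t≤1+d = ℕ.+-cancelˡ-≤ h t (suc d) (begin
        h ℕ.+ t      ≡⟨ i+j≡h+t ⟨
        i ℕ.+ j      ≤⟨ ℕ.+-mono-≤ (dim-mono meet⊑ dim⊓ dimJ)
                          (dim-mono (⊔-lub (H⊑B zero) (Meet-⊑ J (tail H))) dim⊔ dimB) ⟩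
        d ℕ.+ n      ≡⟨ ≡.cong (d ℕ.+_) 1+h≡n ⟨
        d ℕ.+ suc h  ≡⟨ ℕ.+-suc d h ⟩
        suc d ℕ.+ h  ≡⟨ ℕ.+-comm (suc d) h ⟩
        h ℕ.+ suc d  ∎)

    -- The basis dual to a family of hyperplanes.

    othersSpan : ∀ {m} → Vector Carrier m → Fin m → Subspace
    othersSpan b i ._∋_ = ⟨ Others b i ⟩
    othersSpan b i .isSubspace = span-isSubspace (Others b i)

    -- Up to scalars this is the basis dual to functionals with kernels `H i`: `b i` is a nonzero
    -- vector common to all `H j` with j ≠ i, which exists because n - 1 hyperplanes of B cannot
    -- meet in 0.
    dual-basis : ¬ (1# ≈ 0#) → (H : Vector Subspace n) → (∀ i → H i ⊑ B) → (∀ i → Hyperplane (H i)) →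
                 RadoCondition H → ∃[ b ] IsBasis (B ∋_) b × (∀ i → H i ⊑ othersSpan b i)
    dual-basis 1≉0 H H⊑B hyper rado = b , basis , H⊑others
      where
      nonzero : ∀ i → ∃[ x ] Meet (∁ ⁅ i ⁆) H ∋ x × ¬ (⊥ ∋ x)
      nonzero i with dim-⊑ (Meet-⊑ (∁ ⁅ i ⁆) H) dimB
      ... | zero  , dimM = contradiction (Meet-hyperplanes (∁ ⁅ i ⁆) H H⊑B hyper dimM) (ℕ.<⇒≱ ∣∁⁅i⁆∣<n)
        where
        ∣∁⁅i⁆∣<n : ∣ ∁ ⁅ i ⁆ ∣ < n
        ∣∁⁅i⁆∣<n = ≡.subst (∣ ∁ ⁅ i ⁆ ∣ <_) (∣⊤∣≡n n)
          (p⊂q⇒∣p∣<∣q∣ (⊆⊤ , i , ∈⊤ , λ i∈∁ → x∈∁p⇒x∉p i∈∁ (x∈⁅x⁆ i)))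
      ... | suc d , dimM = dim-< dim-⊥ dimM (s≤s z≤n)

      b : Vector Carrier n
      b i = proj₁ (nonzero i)

      b∈B : ∀ i → B ∋ b i
      b∈B i = proj₁ (proj₁ (proj₂ (nonzero i)))

      b∈H : ∀ {i j} → j ≢ i → H i ∋ b j
      b∈H {i} {j} j≢i = proj₂ (proj₁ (proj₂ (nonzero j))) (x∉p⇒x∈∁p λ i∈ → j≢i (≡.sym (x∈⁅y⁆⇒x≡y j i∈)))

      -- Otherwise `b i` lies in every hyperplane, but Rado's condition for the full index set makes
      -- their meet 0.
      b∉H : ∀ i → ¬ (H i ∋ b i)
      b∉H i b∈Hᵢ with dim-⊑ (Meet-⊑ ⊤ H) dimB
      ... | d , dimM = proj₂ (proj₂ (nonzero i))
        (⊑-elim (dim-⊑-≥ (⊥-min _) dim-⊥ dimM d≤0) (b∈B i , λ _ → b∈all _))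
        where
        d≤0 : d ≤ 0
        d≤0 = ℕ.+-cancelʳ-≤ n d 0 (≡.subst (λ k → d ℕ.+ k ≤ n) (∣⊤∣≡n n) (rado ⊤ dimM))
        b∈all : ∀ j → H j ∋ b i
        b∈all j with i ≟ j
        ... | yes ≡.refl = b∈Hᵢ
        ... | no  i≢j    = b∈H i≢j

      -- Modulo `H i` a relation reduces to its i-th term.
      independent : LinearlyIndependent b
      independent k k∈K ∑≈0 i with em {P = k i ≈ 0#}
      ... | yes kᵢ≈0 = kᵢ≈0
      ... | no  kᵢ≉0 = contradiction
        (Hᵢ.unscale (k∈K i) kᵢ≉0 (sum-summand (H i) _ i
          (λ j j≢i → Hᵢ.*-closed (k∈K j) (b∈H j≢i))
          (Hᵢ.resp-≈ (sym ∑≈0) Hᵢ.0∈)))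
        (b∉H i)
        where module Hᵢ = Subspace (H i)

      B⊑span : B ⊑ span b
      B⊑span = dim-⊑-≥ (span-⊑ B b∈B) (independent⇒dim 1≉0 b independent) dimB ℕ.≤-refl

      basis : IsBasis (B ∋_) b
      basis = record { members = b∈B ; independent = independent ; spanning = ⊑-elim B⊑span }

      span⊑ : ∀ i → span b ⊑ othersSpan b i ⊔ line (b i)
      span⊑ i = span-⊑ (othersSpan b i ⊔ line (b i)) b∈
        where
        b∈ : ∀ j → (othersSpan b i ⊔ line (b i)) ∋ b j
        b∈ j with j ≟ i
        ... | yes ≡.refl = ⊑-elim (⊔-upper₂ (othersSpan b i) (line (b i))) (line-∋ (b i))
        ... | no  j≢i    = ⊑-elim (⊔-upper₁ (othersSpan b i) (line (b i))) (incl (j , j≢i , refl))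

      others⊑H : ∀ i → othersSpan b i ⊑ H i
      others⊑H i = ⊑-intro (span-minimal (isSubspace (H i)) λ
        { (j , j≢i , x≈bj) → Subspace.resp-≈ (H i) (sym x≈bj) (b∈H j≢i) })

      -- The component of y along `b i` lies in `H i`, since the other components do, and so it
      -- vanishes.
      H⊑others : ∀ i → H i ⊑ othersSpan b i
      H⊑others i = ⊑-intro λ {y} y∈H →
        let (v , v∈ , z , z∈ , y≈v+z) = ⊑-elim (span⊑ i) (⊑-elim B⊑span (⊑-elim (H⊑B i) y∈H))
            z∈H = Subspace.cancelˡ (H i) y≈v+z y∈H (⊑-elim (others⊑H i) v∈)
            z≈0 = line-∩ (H i) (b∉H i) z∈ z∈H
        in resp (sym (trans y≈v+z (trans (+-congˡ z≈0) (+-identityʳ v)))) v∈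

    matched-basis : ¬ (1# ≈ 0#) → (V : Vector Subspace n) → (∀ i → V i ⊑ B) → RadoCondition V →
                    ∃[ b ] IsBasis (B ∋_) b × (∀ i → V i ⊑ othersSpan b i)
    matched-basis 1≉0 V V⊑B rado =
      let H , enl , hyper = saturate V (List.allFin n) V⊑B rado
          b , basis , H⊑others = dual-basis 1≉0 H (Enlargement.below enl) (λ i → hyper (∈-allFin i))
                                   (Enlargement.isRado enl)
      in b , basis , λ i → ⊑-trans (Enlargement.above enl i) (H⊑others i)

  -- Spans of subfamilies, and transfer between universe levels.

  subspan : ∀ {n} → Subset n → Vector Carrier n → Subspace
  subspan Vec.[]              a = ⊥
  subspan (outside Vec.∷ J) a = subspan J (tail a)
  subspan (inside  Vec.∷ J) a = subspan J (tail a) ⊔ line (head a)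

  subspan-⊑ : ∀ {n} (J : Subset n) a V → (∀ {i} → i ∈ˢ J → V ∋ a i) → subspan J a ⊑ V
  subspan-⊑ Vec.[]              a V a∈V = ⊥-min V
  subspan-⊑ (outside Vec.∷ J) a V a∈V = subspan-⊑ J (tail a) V (a∈V ∘ there)
  subspan-⊑ (inside  Vec.∷ J) a V a∈V = ⊔-lub (subspan-⊑ J (tail a) V (a∈V ∘ there)) (line-min V (a∈V here))

  dim-subspan : ¬ (1# ≈ 0#) → ∀ {n} (J : Subset n) a → LinearlyIndependent a → Dim (subspan J a) ∣ J ∣
  dim-subspan 1≉0 Vec.[]              a ind = dim-⊥
  dim-subspan 1≉0 (outside Vec.∷ J) a ind = dim-subspan 1≉0 J (tail a) (independent-tail a ind)
  dim-subspan 1≉0 (inside  Vec.∷ J) a ind =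
    dim-adjoin (dim-subspan 1≉0 J (tail a) (independent-tail a ind))
      (independent-head 1≉0 a ind ∘ ⊑-elim (subspan-⊑ J (tail a) (span (tail a)) λ {i} _ → incl (i , refl)))

  hasDim-≐ : ∀ {q r} {P : Pred Carrier q} {Q : Pred Carrier r} {n} → P ⊆ Q → Q ⊆ P → HasDim P n → HasDim Q n
  hasDim-≐ P⊆Q Q⊆P (v , basis) = v , record
    { members     = P⊆Q ∘ members
    ; independent = independent
    ; spanning    = spanning ∘ Q⊆P
    }
    where open IsBasis basis

  generated-mono : ∀ {q r} {P : Pred Carrier q} {Q : Pred Carrier r} → P ⊆ Q → Generated P ⊆ Generated Q
  generated-mono P⊆Q = generated-minimal (generated-isSubfield _) (incl ∘ P⊆Q)

  adjoin-mono : ∀ {q r} {P : Pred Carrier q} {Q : Pred Carrier r} → P ⊆ Q → Adjoin P ⊆ Adjoin Q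
  adjoin-mono P⊆Q = generated-mono λ { (inj₁ x∈K) → inj₁ x∈K ; (inj₂ x∈P) → inj₂ (P⊆Q x∈P) }

  fromPred : (P : Pred Carrier p) → IsSubspace P → Subspace
  fromPred P isP ._∋_ x = Lift Λ (P x)
  fromPred P isP .isSubspace = record
    { resp-≈   = λ { x≈y (lift x∈P) → lift (P.resp-≈ x≈y x∈P) }
    ; 0∈       = lift P.0∈
    ; +-closed = λ { (lift x∈P) (lift y∈P) → lift (P.+-closed x∈P y∈P) }
    ; *-closed = λ { k∈K (lift x∈P) → lift (P.*-closed k∈K x∈P) }
    }
    where module P = IsSubspace isP

  -- Excluded middle makes predicates impredicative: a subspace resizes to level p.
  toPred : Subspace → Pred Carrier p
  toPred V x = Lift p (True (em {P = V ∋ x}))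

  toPred⁺ : ∀ V {x} → V ∋ x → toPred V x
  toPred⁺ V x∈V = lift (fromWitness x∈V)

  toPred⁻ : ∀ V {x} → toPred V x → V ∋ x
  toPred⁻ V (lift x∈V) = toWitness x∈V

  toPred-isSubspace : ∀ V → IsSubspace (toPred V)
  toPred-isSubspace V = record
    { resp-≈   = λ x≈y x∈V → toPred⁺ V (V.resp-≈ x≈y (toPred⁻ V x∈V))
    ; 0∈       = toPred⁺ V V.0∈
    ; +-closed = λ x∈V y∈V → toPred⁺ V (V.+-closed (toPred⁻ V x∈V) (toPred⁻ V y∈V))
    ; *-closed = λ k∈K x∈V → toPred⁺ V (V.*-closed k∈K (toPred⁻ V x∈V))
    }
    where module V = Subspace V

  -- Matching a given basis of A.

  matchable : ∀ {n} (A B : Pred Carrier p) → IsSubspace A → IsSubspace B → HasDim B n → 1# ∉ A →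
    ((R : Pred Carrier p) → IsSubspace R → R ⊆ B → Nonzero R →
      ∀ r s → HasDim R r → HasDim (Adjoin R ∩ A) s → s ≥ r) →
    Matchable n A B
  matchable {n} A B isA isB hasDimB 1∉A large a basisA =
    b , record { members = lower ∘ members ; independent = independent ; spanning = spanning ∘ lift } , matched
    where
    Aˢ = fromPred A isA
    Bˢ = fromPred B isB

    1≉0 : ¬ (1# ≈ 0#)
    1≉0 1≈0 = 1∉A (IsSubspace.resp-≈ isA (sym 1≈0) (IsSubspace.0∈ isA))

    dimA : Dim Aˢ n
    dimA = hasDim⇒dim 1≉0 (hasDim-≐ lift lower (a , basisA))

    dimB : Dim Bˢ n
    dimB = hasDim⇒dim 1≉0 (hasDim-≐ lift lower hasDimB)

    adjoin-large : ∀ {R r s} → R ⊑ Bˢ → Nonzero (R ∋_) → Dim R r → Dim (adjoin R ⊓ Aˢ) s → s ≥ r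
    adjoin-large {R} R⊑B (x , x∈R , x≉0) dimR dimKRA =
      -- The hypothesis quantifies over predicates at level `p` while R lives at `Λ`, so it is
      -- applied to the resized copy of R.
      large (toPred R) (toPred-isSubspace R) (lower ∘ ⊑-elim R⊑B ∘ toPred⁻ R)
        (x , toPred⁺ R x∈R , x≉0) _ _
        (hasDim-≐ (toPred⁺ R) (toPred⁻ R) (dim⇒hasDim dimR))
        (hasDim-≐ (λ { (x∈KR , lift x∈A) → adjoin-mono (toPred⁺ R) x∈KR , x∈A })
                  (λ { (x∈KR , x∈A) → adjoin-mono (toPred⁻ R) x∈KR , lift x∈A })
                  (dim⇒hasDim dimKRA))

    open Transform Aˢ Bˢ dimA (1∉A ∘ lower) adjoin-large
    open Transversal Bˢ dimB

    -- This is aᵢ⁻¹A ∩ B, written without inverses as the y in B with aᵢy in A.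
    V : Vector Subspace n
    V i = Bˢ ⊓ preimage (a i) Aˢ

    rado : RadoCondition V
    rado J {d} dimJ = ≡.subst (_≤ n) (ℕ.+-comm ∣ J ∣ d) (dim-+-≤
      (subspan-⊑ J a Aˢ λ {i} _ → lift (IsBasis.members basisA i))
      (Meet-⊑ J V)
      -- For fixed y in the meet, the x with yx ∈ A form a subspace that contains aᵢ for every i in
      -- J, hence the span of these aᵢ.
      (λ {x} {y} x∈S y∈R → Subspace.resp-≈ Aˢ (*-comm y x)
        (⊑-elim (subspan-⊑ J a (preimage y Aˢ) λ {i} i∈J →
          Subspace.resp-≈ Aˢ (*-comm (a i) y) (proj₂ (proj₂ y∈R i∈J))) x∈S))
      (dim-subspan 1≉0 J a (IsBasis.independent basisA)) dimJ)

    transversal = matched-basis 1≉0 V (λ i → ⊓-lower₁ Bˢ (preimage (a i) Aˢ)) rado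
    b = proj₁ transversal
    open IsBasis (proj₁ (proj₂ transversal))

    matched : MatchedBases A B a b
    matched i {y} ((aᵢ⁻¹ , aᵢaᵢ⁻¹≈1 , x , x∈A , y≈aᵢ⁻¹x) , y∈B) =
      ⊑-elim (proj₂ (proj₂ transversal) i)
        (lift y∈B , lift (IsSubspace.resp-≈ isA (sym aᵢy≈x) x∈A))
      where
      open ≈-Reasoning
      aᵢy≈x : a i * y ≈ x
      aᵢy≈x = begin
        a i * y           ≈⟨ *-congˡ y≈aᵢ⁻¹x ⟩
        a i * (aᵢ⁻¹ * x)  ≈⟨ *-assoc (a i) aᵢ⁻¹ x ⟨
        a i * aᵢ⁻¹ * x    ≈⟨ *-congʳ aᵢaᵢ⁻¹≈1 ⟩
        1# * x            ≈⟨ *-identityˡ x ⟩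
        x                 ∎

corollary3p7 : (∀ {a} → ExcludedMiddle a) →
    ∀ {c ℓ₁ ℓ₂ p} (L : HeytingField c ℓ₁ ℓ₂) →
    let open HeytingField L
        open Subfields L in
    (K : Pred Carrier p) → IsSubfield K → K ⊂ U →
    let open LinearAlgebra L K in
    (n : ℕ) → n > 0 →
    (A B : Pred Carrier p) →
    IsSubspace A → HasDim A n →
    IsSubspace B → HasDim B n →
    1# ∉ A →
    ((R : Pred Carrier p) → IsSubspace R → R ⊆ B → Nonzero R →
      ∀ r s → HasDim R r → HasDim (Adjoin R ∩ A) s → s ≥ r) →
    Matchable n A B
corollary3p7 em L K isSubfield _ n _ A B isA _ isB hasDimB 1∉A large =
  Subspaces.matchable em L K isSubfield A B isA isB hasDimB 1∉A large
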